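{- Let $n\ge d\ge 1$ and $0<\delta<1$. Any $e_{n,d}$-support intersection certification algorithm with one-sided error $\delta$ makes at least $2^{d-1}$ queries.
   Context: $\mathcal{S}_d^n=\mathbb{C}[x_1,\ldots,x_n]_d$; $e_{n,d}=\sum_{1\le i_1<\cdots<i_d\le n}x_{i_1}\cdots x_{i_d}$. For $f=\sum_\alpha c_\alpha x^\alpha$, $\mathrm{supp}(f)=\{\alpha\in\mathbb{N}^n: c_\alpha\ne0\}$. For $g\in\mathcal{S}_d^n$ and $0<\delta<1$, a $g$-support intersection certification algorithm with one-sided error $\delta$ is a (randomized) algorithm which, given any $f\in\mathcal{S}_d^n$ as a black box, always outputs "$\mathrm{supp}(f)\cap\mathrm{supp}(g)=\emptyset$" on all instances $f$ where $\mathrm{supp}(f)\cap\mathrm{supp}(g)=\emptyset$, and correctly outputs "$\mathrm{supp}(f)\cap\mathrm{supp}(g)\ne\emptyset$" with probability at least $1-\delta$ on all instances where $\mathrm{supp}(f)\cap\mathrm{supp}(g)\neq\emptyset$. A query is the choice of a point $v\in\mathbb{C}^n$, answered by $f(v)$; queries may be adaptive, and the number of queries is counted in the worst case. Arithmetic is exact. -}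

module Defs where

open import Algebra.Bundles using (CommutativeMonoid; RawSemiring)
import Algebra.Definitions.RawSemiring as RawSemiringDefinitions
import Algebra.Properties.CommutativeSemigroup as CommutativeSemigroupProperties
open import Data.Bool.Base using (if_then_else_)
open import Data.Fin.Subset using (Subset; inside; outside; ∣_∣)
open import Data.List.Base as List using (List; []; _∷_; _++_)
open import Data.List.Relation.Unary.All as All using (All)
import Data.List.Relation.Unary.All.Properties as All
open import Data.Nat.Base as ℕ using (ℕ; zero; suc)
import Data.Nat.Properties as ℕ
open import Data.Product.Base using (Σ; ∃; _×_; _,_; proj₁; proj₂)
open import Data.Rational.Base as ℚ using (ℚ; 0ℚ; 1ℚ; ½)
import Data.Rational.Properties as ℚ
open import Data.Vec.Base as Vec using (Vec; []; _∷_)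
open import Data.Vec.Properties using (≡-dec)
open import Data.Vec.Relation.Binary.Pointwise.Inductive using (Pointwise)
open import Data.Empty using (⊥)
open import Level using (0ℓ) renaming (suc to lsuc)
open import Relation.Binary.PropositionalEquality
  using (_≡_; _≢_; refl; sym; trans; cong; cong₂; subst)
open import Relation.Nullary using (¬_)
open import Relation.Unary
  using (Pred; Satisfiable; Empty; U; ∅; ∁; _≐_; _∩_; ⋃)

Eventually : Pred ℕ 0ℓ → Set
Eventually P = ∃ λ N → ∀ n → N ℕ.≤ n → P n

Cauchy : (ℕ → ℚ) → Set
Cauchy x = ∀ ε → 0ℚ ℚ.< ε →
  ∃ λ N → ∀ m n → N ℕ.≤ m → N ℕ.≤ n → ℚ.∣ x m ℚ.- x n ∣ ℚ.< ε

-- Two sequences represent the same real when their difference is null;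
-- this is _≈ᴿ_ below, not _≡_.
record ℝ : Set where
  constructor mkℝ
  field
    seq    : ℕ → ℚ
    cauchy : Cauchy seq

open ℝ public

infix 4 _≈ᴿ_ _≤ᴿ_ _<ᴿ_

_≈ᴿ_ _≤ᴿ_ _<ᴿ_ : ℝ → ℝ → Set
x ≈ᴿ y = ∀ ε → 0ℚ ℚ.< ε → Eventually λ n → ℚ.∣ seq x n ℚ.- seq y n ∣ ℚ.< ε
x ≤ᴿ y = ∀ ε → 0ℚ ℚ.< ε → Eventually λ n → seq x n ℚ.≤ seq y n ℚ.+ ε
x <ᴿ y = ∃ λ ε → 0ℚ ℚ.< ε × Eventually λ n → seq x n ℚ.+ ε ℚ.≤ seq y n

private

  open CommutativeSemigroupProperties
    (CommutativeMonoid.commutativeSemigroup ℚ.+-0-commutativeMonoid)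
    using (interchange)

-- Abstract so that conversion checking never unfolds moduli of convergence.
abstract

  minus-plus : ∀ a b → (a ℚ.- b) ℚ.+ b ≡ a
  minus-plus a b = trans (ℚ.+-assoc a (ℚ.- b) b)
    (trans (cong (a ℚ.+_) (ℚ.+-inverseˡ b)) (ℚ.+-identityʳ a))

  *-distrib-minus : ∀ a b c → a ℚ.* (b ℚ.- c) ≡ a ℚ.* b ℚ.- a ℚ.* c
  *-distrib-minus a b c = trans (ℚ.*-distribˡ-+ a b (ℚ.- c))
    (cong (a ℚ.* b ℚ.+_) (sym (ℚ.neg-distribʳ-* a c)))

  halves : ∀ ε → ½ ℚ.* ε ℚ.+ ½ ℚ.* ε ≡ ε
  halves ε = trans (sym (ℚ.*-distribʳ-+ ε ½ ½)) (ℚ.*-identityˡ ε)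

  half-pos : ∀ {ε} → 0ℚ ℚ.< ε → 0ℚ ℚ.< ½ ℚ.* ε
  half-pos {ε} 0<ε =
    subst (ℚ._< ½ ℚ.* ε) (ℚ.*-zeroʳ ½) (ℚ.*-monoʳ-<-pos ½ 0<ε)

  const-cauchy : ∀ q → Cauchy (λ _ → q)
  const-cauchy q ε 0<ε =
    0 , λ _ _ _ _ → subst (λ r → ℚ.∣ r ∣ ℚ.< ε) (sym (ℚ.+-inverseʳ q)) 0<ε

  neg-cauchy : ∀ {x} → Cauchy x → Cauchy (λ n → ℚ.- x n)
  neg-cauchy {x} cx ε 0<ε with cx ε 0<ε
  ... | N , close = N , λ m n N≤m N≤n →
    subst (ℚ._< ε)
      (trans (sym (ℚ.∣-p∣≡∣p∣ _)) (cong ℚ.∣_∣ (ℚ.neg-distrib-+ (x m) (ℚ.- x n))))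
      (close m n N≤m N≤n)

  +-cauchy : ∀ {x y} → Cauchy x → Cauchy y → Cauchy (λ n → x n ℚ.+ y n)
  +-cauchy {x} {y} cx cy ε 0<ε
    with cx (½ ℚ.* ε) (half-pos 0<ε) | cy (½ ℚ.* ε) (half-pos 0<ε)
  ... | M , closeˣ | N , closeʸ = M ℕ.⊔ N , λ m n m≥ n≥ → begin-strict
      ℚ.∣ (x m ℚ.+ y m) ℚ.- (x n ℚ.+ y n) ∣
        ≡⟨ cong ℚ.∣_∣ (rearrange (x m) (y m) (x n) (y n)) ⟩
      ℚ.∣ (x m ℚ.- x n) ℚ.+ (y m ℚ.- y n) ∣
        ≤⟨ ℚ.∣p+q∣≤∣p∣+∣q∣ (x m ℚ.- x n) (y m ℚ.- y n) ⟩
      ℚ.∣ x m ℚ.- x n ∣ ℚ.+ ℚ.∣ y m ℚ.- y n ∣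
        <⟨ ℚ.+-mono-< (closeˣ m n (ℕ.m⊔n≤o⇒m≤o M N m≥) (ℕ.m⊔n≤o⇒m≤o M N n≥))
                      (closeʸ m n (ℕ.m⊔n≤o⇒n≤o M N m≥) (ℕ.m⊔n≤o⇒n≤o M N n≥)) ⟩
      ½ ℚ.* ε ℚ.+ ½ ℚ.* ε
        ≡⟨ halves ε ⟩
      ε ∎
    where
    open ℚ.≤-Reasoning
    rearrange : ∀ a b c d → (a ℚ.+ b) ℚ.- (c ℚ.+ d) ≡ (a ℚ.- c) ℚ.+ (b ℚ.- d)
    rearrange a b c d = trans (cong ((a ℚ.+ b) ℚ.+_) (ℚ.neg-distrib-+ c d))
                              (interchange a b (ℚ.- c) (ℚ.- d))

  eventually-bounded : ∀ {x} → Cauchy x →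
    ∃ λ B → 0ℚ ℚ.< B × Eventually λ n → ℚ.∣ x n ∣ ℚ.≤ B
  eventually-bounded {x} cx with cx 1ℚ (ℚ.positive⁻¹ 1ℚ)
  ... | N , close = B , 0<B , N , λ n N≤n → begin
      ℚ.∣ x n ∣                         ≡⟨ cong ℚ.∣_∣ (sym (minus-plus (x n) (x N))) ⟩
      ℚ.∣ (x n ℚ.- x N) ℚ.+ x N ∣       ≤⟨ ℚ.∣p+q∣≤∣p∣+∣q∣ (x n ℚ.- x N) (x N) ⟩
      ℚ.∣ x n ℚ.- x N ∣ ℚ.+ ℚ.∣ x N ∣   ≤⟨ ℚ.+-monoˡ-≤ ℚ.∣ x N ∣ (ℚ.<⇒≤ (close n N N≤n ℕ.≤-refl)) ⟩
      B                                 ∎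
    where
    open ℚ.≤-Reasoning
    B : ℚ
    B = 1ℚ ℚ.+ ℚ.∣ x N ∣
    0<B : 0ℚ ℚ.< B
    0<B = ℚ.+-mono-<-≤ (ℚ.positive⁻¹ 1ℚ) (ℚ.0≤∣p∣ (x N))

  scale : ∀ B → 0ℚ ℚ.< B → ∀ ε → 0ℚ ℚ.< ε →
    ∃ λ η → 0ℚ ℚ.< η × B ℚ.* η ≡ ½ ℚ.* ε
  scale B 0<B ε 0<ε = η , 0<η , Bη
    where
    instance
      B-pos : ℚ.Positive B
      B-pos = ℚ.positive 0<B
      B-nonZero : ℚ.NonZero B
      B-nonZero = ℚ.pos⇒nonZero B
      B⁻¹-pos : ℚ.Positive (ℚ.1/ B)
      B⁻¹-pos = ℚ.1/pos⇒pos B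
    η : ℚ
    η = ℚ.1/ B ℚ.* (½ ℚ.* ε)
    0<η : 0ℚ ℚ.< η
    0<η = subst (ℚ._< η) (ℚ.*-zeroʳ (ℚ.1/ B)) (ℚ.*-monoʳ-<-pos (ℚ.1/ B) (half-pos 0<ε))
    Bη : B ℚ.* η ≡ ½ ℚ.* ε
    Bη = trans (sym (ℚ.*-assoc B (ℚ.1/ B) (½ ℚ.* ε)))
      (trans (cong (ℚ._* (½ ℚ.* ε)) (ℚ.*-inverseʳ B)) (ℚ.*-identityˡ (½ ℚ.* ε)))

  *-bound : ∀ {p q B η} → 0ℚ ℚ.< B → ℚ.∣ p ∣ ℚ.≤ B → ℚ.∣ q ∣ ℚ.< η →
            ℚ.∣ p ∣ ℚ.* ℚ.∣ q ∣ ℚ.< B ℚ.* η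
  *-bound {p} {q} {B} {η} 0<B p≤B q<η = begin-strict
      ℚ.∣ p ∣ ℚ.* ℚ.∣ q ∣   ≤⟨ ℚ.*-monoʳ-≤-nonNeg ℚ.∣ q ∣ p≤B ⟩
      B ℚ.* ℚ.∣ q ∣         <⟨ ℚ.*-monoʳ-<-pos B q<η ⟩
      B ℚ.* η               ∎
    where
    open ℚ.≤-Reasoning
    instance
      q-nonNeg : ℚ.NonNegative ℚ.∣ q ∣
      q-nonNeg = ℚ.∣-∣-nonNeg q
      B-pos : ℚ.Positive B
      B-pos = ℚ.positive 0<B

  *-cauchy : ∀ {x y} → Cauchy x → Cauchy y → Cauchy (λ n → x n ℚ.* y n)
  *-cauchy {x} {y} cx cy ε 0<ε
    with eventually-bounded cx | eventually-bounded cy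
  ... | A , 0<A , K , x≤A | B , 0<B , L , y≤B
    with scale A 0<A ε 0<ε | scale B 0<B ε 0<ε
  ... | α , 0<α , Aα | β , 0<β , Bβ
    with cx β 0<β | cy α 0<α
  ... | M , closeˣ | N , closeʸ = K ℕ.⊔ L ℕ.⊔ (M ℕ.⊔ N) , λ m n m≥ n≥ →
    let
      KL≤m = ℕ.m⊔n≤o⇒m≤o (K ℕ.⊔ L) (M ℕ.⊔ N) m≥
      KL≤n = ℕ.m⊔n≤o⇒m≤o (K ℕ.⊔ L) (M ℕ.⊔ N) n≥
      MN≤m = ℕ.m⊔n≤o⇒n≤o (K ℕ.⊔ L) (M ℕ.⊔ N) m≥
      MN≤n = ℕ.m⊔n≤o⇒n≤o (K ℕ.⊔ L) (M ℕ.⊔ N) n≥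
    in begin-strict
      ℚ.∣ x m ℚ.* y m ℚ.- x n ℚ.* y n ∣
        ≡⟨ cong ℚ.∣_∣ (rearrange (x m) (y m) (x n) (y n)) ⟩
      ℚ.∣ x m ℚ.* (y m ℚ.- y n) ℚ.+ y n ℚ.* (x m ℚ.- x n) ∣
        ≤⟨ ℚ.∣p+q∣≤∣p∣+∣q∣ (x m ℚ.* (y m ℚ.- y n)) (y n ℚ.* (x m ℚ.- x n)) ⟩
      ℚ.∣ x m ℚ.* (y m ℚ.- y n) ∣ ℚ.+ ℚ.∣ y n ℚ.* (x m ℚ.- x n) ∣
        ≡⟨ cong₂ ℚ._+_ (ℚ.∣p*q∣≡∣p∣*∣q∣ (x m) (y m ℚ.- y n))
                       (ℚ.∣p*q∣≡∣p∣*∣q∣ (y n) (x m ℚ.- x n)) ⟩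
      ℚ.∣ x m ∣ ℚ.* ℚ.∣ y m ℚ.- y n ∣ ℚ.+ ℚ.∣ y n ∣ ℚ.* ℚ.∣ x m ℚ.- x n ∣
        <⟨ ℚ.+-mono-<
             (*-bound {x m} {y m ℚ.- y n} {A} {α} 0<A (x≤A m (ℕ.m⊔n≤o⇒m≤o K L KL≤m))
               (closeʸ m n (ℕ.m⊔n≤o⇒n≤o M N MN≤m) (ℕ.m⊔n≤o⇒n≤o M N MN≤n)))
             (*-bound {y n} {x m ℚ.- x n} {B} {β} 0<B (y≤B n (ℕ.m⊔n≤o⇒n≤o K L KL≤n))
               (closeˣ m n (ℕ.m⊔n≤o⇒m≤o M N MN≤m) (ℕ.m⊔n≤o⇒m≤o M N MN≤n))) ⟩
      A ℚ.* α ℚ.+ B ℚ.* β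
        ≡⟨ cong₂ ℚ._+_ Aα Bβ ⟩
      ½ ℚ.* ε ℚ.+ ½ ℚ.* ε
        ≡⟨ halves ε ⟩
      ε ∎
    where
    open ℚ.≤-Reasoning
    rearrange : ∀ a b c d →
      a ℚ.* b ℚ.- c ℚ.* d ≡ a ℚ.* (b ℚ.- d) ℚ.+ d ℚ.* (a ℚ.- c)
    rearrange a b c d = trans
      (cong (ℚ._- c ℚ.* d) (sym (minus-plus (a ℚ.* b) (a ℚ.* d))))
      (trans (ℚ.+-assoc (a ℚ.* b ℚ.- a ℚ.* d) (a ℚ.* d) (ℚ.- (c ℚ.* d)))
        (cong₂ ℚ._+_ (sym (*-distrib-minus a b d))
          (trans (cong₂ ℚ._-_ (ℚ.*-comm a d) (ℚ.*-comm c d)) (sym (*-distrib-minus d a c)))))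

infixl 6 _+ᴿ_ _-ᴿ_
infixl 7 _*ᴿ_
infix  8 -ᴿ_

fromℚ : ℚ → ℝ
fromℚ q = mkℝ (λ _ → q) (const-cauchy q)

0ᴿ 1ᴿ : ℝ
0ᴿ = fromℚ 0ℚ
1ᴿ = fromℚ 1ℚ

_+ᴿ_ _*ᴿ_ : ℝ → ℝ → ℝ
x +ᴿ y = mkℝ (λ n → seq x n ℚ.+ seq y n) (+-cauchy {seq x} {seq y} (cauchy x) (cauchy y))
x *ᴿ y = mkℝ (λ n → seq x n ℚ.* seq y n) (*-cauchy {seq x} {seq y} (cauchy x) (cauchy y))

-ᴿ_ : ℝ → ℝ
-ᴿ x = mkℝ (λ n → ℚ.- seq x n) (neg-cauchy {seq x} (cauchy x))

_-ᴿ_ : ℝ → ℝ → ℝ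
x -ᴿ y = x +ᴿ (-ᴿ y)

infix 4 _⟶_

_⟶_ : (ℕ → ℝ) → ℝ → Set
s ⟶ l = ∀ ε → 0ℚ ℚ.< ε →
  Eventually λ n → s n ≤ᴿ l +ᴿ fromℚ ε × l ≤ᴿ s n +ᴿ fromℚ ε

partialSums : (ℕ → ℝ) → ℕ → ℝ
partialSums s zero    = 0ᴿ
partialSums s (suc n) = partialSums s n +ᴿ s n

infix 5 _+i_

record ℂ : Set where
  constructor _+i_
  field
    re im : ℝ

open ℂ public

infix  4 _≈ᶜ_ _≉ᶜ_
infixl 6 _+ᶜ_
infixl 7 _*ᶜ_

_≈ᶜ_ _≉ᶜ_ : ℂ → ℂ → Set
z ≈ᶜ w = re z ≈ᴿ re w × im z ≈ᴿ im w
z ≉ᶜ w = ¬ (z ≈ᶜ w)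

0ᶜ 1ᶜ : ℂ
0ᶜ = 0ᴿ +i 0ᴿ
1ᶜ = 1ᴿ +i 0ᴿ

_+ᶜ_ _*ᶜ_ : ℂ → ℂ → ℂ
(a +i b) +ᶜ (c +i d) = (a +ᴿ c) +i (b +ᴿ d)
(a +i b) *ᶜ (c +i d) = (a *ᴿ c -ᴿ b *ᴿ d) +i (a *ᴿ d +ᴿ b *ᴿ c)

ℂ-rawSemiring : RawSemiring 0ℓ 0ℓ
ℂ-rawSemiring = record
  { Carrier = ℂ ; _≈_ = _≈ᶜ_ ; _+_ = _+ᶜ_ ; _*_ = _*ᶜ_ ; 0# = 0ᶜ ; 1# = 1ᶜ }

open RawSemiringDefinitions ℂ-rawSemiring public
  using () renaming (_^_ to _^ᶜ_)

sumᶜ : List ℂ → ℂ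
sumᶜ = List.foldr _+ᶜ_ 0ᶜ

Exponent : ℕ → Set
Exponent n = Vec ℕ n

Point : ℕ → Set
Point n = Vec ℂ n

-- A form is given as a formal sum of terms c · x^α with ∣α∣ = d.  An
-- exponent may be repeated and c may vanish, so only the collected
-- coefficients below are meaningful.
record Form (n d : ℕ) : Set where
  constructor mkForm
  field
    terms       : List (ℂ × Exponent n)
    homogeneous : All (λ t → Vec.sum (proj₂ t) ≡ d) terms

open Form public

coefficient : ∀ {n d} → Form n d → Exponent n → ℂ
coefficient f α =
  sumᶜ (List.map proj₁ (List.filter (λ t → ≡-dec ℕ._≟_ (proj₂ t) α) (terms f)))

supp : ∀ {n d} → Form n d → Pred (Exponent n) 0ℓ
supp f α = coefficient f α ≉ᶜ 0ᶜ

infixr 8 _^^_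

_^^_ : ∀ {n} → Point n → Exponent n → ℂ
v ^^ α = Vec.foldr′ _*ᶜ_ 1ᶜ (Vec.zipWith _^ᶜ_ v α)

eval : ∀ {n d} → Form n d → Point n → ℂ
eval f v = sumᶜ (List.map (λ t → proj₁ t *ᶜ v ^^ proj₂ t) (terms f))

subsets : ∀ n → List (Subset n)
subsets zero    = [] ∷ []
subsets (suc n) = List.map (inside ∷_) (subsets n) ++ List.map (outside ∷_) (subsets n)

indicator : ∀ {n} → Subset n → Exponent n
indicator = Vec.map λ side → if side then 1 else 0

private

  sum-indicator : ∀ {n} (S : Subset n) → Vec.sum (indicator S) ≡ ∣ S ∣
  sum-indicator []            = refl
  sum-indicator (inside  ∷ S) = cong suc (sum-indicator S)
  sum-indicator (outside ∷ S) = sum-indicator S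

-- A choice of 1 ≤ i₁ < ⋯ < i_d ≤ n is a d-element subset of Fin n.
elementary : ∀ n d → Form n d
elementary n d = mkForm
  (List.map (λ S → 1ᶜ , indicator S) chosen)
  (All.map⁺ (All.map (λ {S} ∣S∣≡d → trans (sum-indicator S) ∣S∣≡d)
                     (All.all-filter (λ S → ∣ S ∣ ℕ.≟ d) (subsets n))))
  where
  chosen : List (Subset n)
  chosen = List.filter (λ S → ∣ S ∣ ℕ.≟ d) (subsets n)

record ProbabilitySpace : Set₂ where
  field
    Ω          : Set
    Measurable : Pred (Pred Ω 0ℓ) (lsuc 0ℓ)
    resp       : ∀ {E F} → E ≐ F → Measurable E → Measurable F
    whole      : Measurable U
    complement : ∀ {E} → Measurable E → Measurable (∁ E)
    union      : ∀ {E : ℕ → Pred Ω 0ℓ} →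
                 (∀ i → Measurable (E i)) → Measurable (⋃ ℕ E)

    ℙ          : (E : Pred Ω 0ℓ) → Measurable E → ℝ
    ℙ-cong     : ∀ {E F} (mE : Measurable E) (mF : Measurable F) →
                 E ≐ F → ℙ E mE ≈ᴿ ℙ F mF
    ℙ-nonneg   : ∀ {E} (mE : Measurable E) → 0ᴿ ≤ᴿ ℙ E mE
    ℙ-whole    : ℙ U whole ≈ᴿ 1ᴿ
    ℙ-additive : ∀ {E : ℕ → Pred Ω 0ℓ} (mE : ∀ i → Measurable (E i)) →
                 (∀ {i j} → i ≢ j → Empty (E i ∩ E j)) →
                 partialSums (λ i → ℙ (E i) (mE i)) ⟶ ℙ (⋃ ℕ E) (union mE)

data Verdict : Set where
  disjoint intersecting : Verdict

data Strategy (n : ℕ) : Set where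
  output : Verdict → Strategy n
  query  : Point n → (ℂ → Strategy n) → Strategy n

-- Equality of strategies up to equality of complex numbers.  It is only
-- a partial equivalence: s ≋ s says that s depends on the answers as
-- complex numbers, not on the sequences that represent them.
infix 4 _≋_

_≋_ : ∀ {n} → Strategy n → Strategy n → Set
output a  ≋ output b  = a ≡ b
output _  ≋ query _ _ = ⊥
query _ _ ≋ output _  = ⊥
query v k ≋ query w l = Pointwise _≈ᶜ_ v w × (∀ y z → y ≈ᶜ z → k y ≋ l z)

verdict : ∀ {n} → Strategy n → (Point n → ℂ) → Verdict
verdict (output b)  f = b
verdict (query v k) f = verdict (k (f v)) f

queries : ∀ {n} → Strategy n → (Point n → ℂ) → ℕ
queries (output _)  f = 0
queries (query v k) f = suc (queries (k (f v)) f)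

-- All randomness is drawn in advance, as a point ω of a probability space.
record RandomizedAlgorithm (n d : ℕ) : Set₂ where
  field
    space : ProbabilitySpace

  open ProbabilitySpace space public

  field
    strategy    : Ω → Strategy n
    extensional : ∀ ω → strategy ω ≋ strategy ω

  verdictOn : Form n d → Ω → Verdict
  verdictOn f ω = verdict (strategy ω) (eval f)

  queriesOn : Form n d → Ω → ℕ
  queriesOn f ω = queries (strategy ω) (eval f)

  Outputs : Verdict → Form n d → Pred Ω 0ℓ
  Outputs b f ω = verdictOn f ω ≡ b

  field
    measurable : ∀ b f → Measurable (Outputs b f)

record CertifiesIntersection {n d : ℕ} (g : Form n d) (δ : ℝ)
    (A : RandomizedAlgorithm n d) : Set where
  open RandomizedAlgorithm A
  field
    on-disjoint     : ∀ f → Empty (supp f ∩ supp g) →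
                      ∀ ω → verdictOn f ω ≡ disjoint
    on-intersecting : ∀ f → Satisfiable (supp f ∩ supp g) →
                      1ᴿ -ᴿ δ ≤ᴿ ℙ (Outputs intersecting f) (measurable intersecting f)

-- Lower bound on the supremum, over all inputs and all random choices,
-- of the number of queries.
WorstCaseQueries≥ : ∀ {n d} → RandomizedAlgorithm n d → ℕ → Set
WorstCaseQueries≥ A k = ∀ q → (∀ f ω → queriesOn f ω ℕ.≤ q) → k ℕ.≤ q
  where open RandomizedAlgorithm A

{-# OPTIONS --safe #-}
module Submission where

-- On a run that answers "intersecting" for f = x₁⋯x_d, let Z be the set of
-- queried points.  No form without squarefree monomials may agree with f on Z,
-- since it would receive the same answer.  Such a form exists when Z has fewer
-- than 2^(d−1) points: the 2^(d−1) forms x₁^(d−1−∣T∣) x^T, T ⊆ {2,…,d}, are then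
-- linearly dependent on Z.  In a dependence Σ c_T x₁^(d−1−∣T∣) x^T take S of
-- maximal size with c_S ≠ 0, divide by x₁^(d−1−∣S∣) and multiply by
-- x₁ x^({2,…,d}∖S).  The result still vanishes on Z (where x₁ = 0 because of the
-- factor x₁), and its only squarefree term is c_S x₁⋯x_d.  Zero tests on ℂ are
-- undecidable, but the goal is a contradiction, so double negations suffice.

open import Defs
open import Algebra.Bundles using (CommutativeRing)
import Algebra.Consequences.Setoid as Consequences
import Algebra.Definitions
import Algebra.Properties.CommutativeSemigroup as CommutativeSemigroupProperties
import Algebra.Properties.Ring as RingProperties
import Algebra.Properties.Semiring.Sum as SemiringSum
open import Data.Empty using (⊥; ⊥-elim)
open import Data.Fin.Base using (Fin; zero; suc; punchIn; remQuot; combine)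
import Data.Fin.Properties as Fin
open import Data.Fin.Subset using (Subset; Side; inside; outside; ∣_∣; ∁)
  renaming (⊤ to ⊤ˢ; ⊥ to ⊥ˢ)
open import Data.Fin.Subset.Properties using (∣p∣≤n; ∣⊥∣≡0; ∣⊤∣≡n; ∣∁p∣≡n∸∣p∣)
open import Data.List.Base as List using (List; []; _∷_; length; filter; allFin)
open import Data.List.Membership.Propositional using (_∈_)
open import Data.List.Membership.Propositional.Properties
  using (∈-map⁺; ∈-filter⁺; ∈-++⁺ˡ; ∈-++⁺ʳ)
import Data.List.Properties as List
open import Data.List.Relation.Unary.All as All using (All; []; _∷_)
import Data.List.Relation.Unary.All.Properties as All
open import Data.List.Relation.Unary.Any using (here)
open import Data.Nat.Base as ℕ using (ℕ; zero; suc; _≤_; _^_; _∸_)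
import Data.Nat.Properties as ℕ
open import Data.Product.Base using (∃; ∃₂; _×_; _,_; proj₁; proj₂)
open import Data.Rational.Base as ℚ using (ℚ; 0ℚ; 1ℚ; ½)
import Data.Rational.Properties as ℚ
open import Data.Rational.Solver using (module +-*-Solver)
open import Data.Sum.Base using (inj₁; inj₂)
open import Data.Vec.Base as Vec using ([]; _∷_; zipWith)
open import Data.Vec.Functional using (insertAt)
open import Data.Vec.Functional.Properties using (insertAt-lookup; insertAt-punchIn)
import Data.Vec.Properties as Vec
open import Data.Vec.Relation.Binary.Pointwise.Inductive using (Pointwise; []; _∷_)
import Data.Vec.Relation.Unary.All as VecAll
open import Function.Base using (_∘_)
open import Level using (0ℓ)
import Relation.Binary.PropositionalEquality as ≡
import Relation.Binary.Reasoning.Setoid as SetoidReasoning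
open import Relation.Binary.Bundles using (Setoid)
open import Relation.Binary.Structures using (IsEquivalence)
open import Relation.Nullary using (¬_; yes; no)
open import Relation.Nullary.Decidable using (¬¬-excluded-middle)
open import Relation.Nullary.Negation using (contradiction)
open import Relation.Unary using (Pred; Decidable; Empty; Satisfiable; _∩_)

open +-*-Solver using (solve; _:+_; _:*_; :-_; _:-_; _:=_; con)
open ≡ using (_≡_; _≢_)

-- Linear dependence over a field with undecidable equality

-- Equality is not decidable, so inverses are only required up to double negation.
record StableField : Set₁ where
  field
    commutativeRing : CommutativeRing 0ℓ 0ℓ
  open CommutativeRing commutativeRing public hiding (zero)
  field
    stable     : ∀ x y → ¬ ¬ x ≈ y → x ≈ y
    1≉0        : ¬ 1# ≈ 0#
    invertible : ∀ x → ¬ x ≈ 0# → ¬ ¬ ∃ λ y → x * y ≈ 1#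

module Elimination (F : StableField) where

  open StableField F
  open RingProperties ring
  open SemiringSum semiring
  open SetoidReasoning setoid

  sum-removeAt-product : ∀ {N} (s : Fin (suc N)) (r c : Fin (suc N) → Carrier) →
    sum (λ j → r j * c j) ≈ r s * c s + sum (λ j → r (punchIn s j) * c (punchIn s j))
  sum-removeAt-product s r c = sum-remove {i = s} (λ j → r j * c j)

  sum-zero : ∀ {N} (t : Fin N → Carrier) → (∀ j → t j ≈ 0#) → sum t ≈ 0#
  sum-zero {N} t t≈0 = trans (sum-cong-≋ t≈0) (sum-replicate-zero N)

  -- Row `s` after the unknown `j₀` has been expressed through the others by means of row `r`. The
  -- argument `b` stands for the inverse of `r j₀`.
  eliminate : ∀ {N} (j₀ : Fin (suc N)) (r : Fin (suc N) → Carrier) → Carrier →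
    (Fin (suc N) → Carrier) → Fin N → Carrier
  eliminate j₀ r b s j = s (punchIn j₀ j) - s j₀ * (b * r (punchIn j₀ j))

  module _ {N} (j₀ : Fin (suc N)) (r : Fin (suc N) → Carrier) (b : Carrier)
    (c : Fin N → Carrier) where

    rest : (Fin (suc N) → Carrier) → Carrier
    rest s = sum (λ j → s (punchIn j₀ j) * c j)

    -- Back substitution: when `b` inverts `r j₀`, the value at `j₀` is the one that makes row `r`
    -- vanish.
    extended : Fin (suc N) → Carrier
    extended = insertAt c j₀ (- (b * rest r))

    sum-extended : ∀ s → sum (λ j → s j * extended j) ≈ rest s - s j₀ * (b * rest r)
    sum-extended s = begin
      sum (λ j → s j * extended j)
        ≈⟨ sum-removeAt-product j₀ s extended ⟩
      s j₀ * extended j₀ + sum (λ j → s (punchIn j₀ j) * extended (punchIn j₀ j))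
        ≈⟨ +-cong (*-congˡ (reflexive (insertAt-lookup c j₀ _)))
             (sum-cong-≋ λ j → *-congˡ (reflexive (insertAt-punchIn c j₀ _ j))) ⟩
      s j₀ * - (b * rest r) + rest s
        ≈⟨ +-comm _ _ ⟩
      rest s + s j₀ * - (b * rest r)
        ≈⟨ +-congˡ (-‿distribʳ-* (s j₀) (b * rest r)) ⟨
      rest s - s j₀ * (b * rest r) ∎

    -- The right-hand side is that of `sum-extended`, so `c` annihilates the eliminated row exactly
    -- when `extended` annihilates `s`.
    sum-eliminate : ∀ s → sum (λ j → eliminate j₀ r b s j * c j) ≈ rest s - s j₀ * (b * rest r)
    sum-eliminate s = begin
      sum (λ j → eliminate j₀ r b s j * c j)
        ≈⟨ sum-cong-≋ (λ j → termwise (s (punchIn j₀ j)) (r (punchIn j₀ j)) (c j)) ⟩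
      sum (λ j → s (punchIn j₀ j) * c j + - (s j₀ * b) * (r (punchIn j₀ j) * c j))
        ≈⟨ ∑-distrib-+ (λ j → s (punchIn j₀ j) * c j) _ ⟩
      rest s + sum (λ j → - (s j₀ * b) * (r (punchIn j₀ j) * c j))
        ≈⟨ +-congˡ (*-distribˡ-sum (- (s j₀ * b)) (λ j → r (punchIn j₀ j) * c j)) ⟨
      rest s + - (s j₀ * b) * rest r
        ≈⟨ +-congˡ (-‿distribˡ-* (s j₀ * b) (rest r)) ⟨
      rest s - s j₀ * b * rest r
        ≈⟨ +-congˡ (-‿cong (*-assoc (s j₀) b (rest r))) ⟩
      rest s - s j₀ * (b * rest r) ∎
      where
      termwise : ∀ x y z → (x - s j₀ * (b * y)) * z ≈ x * z + - (s j₀ * b) * (y * z)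
      termwise x y z = begin
        (x - s j₀ * (b * y)) * z        ≈⟨ distribʳ z x (- (s j₀ * (b * y))) ⟩
        x * z + - (s j₀ * (b * y)) * z  ≈⟨ +-congˡ (*-congʳ (-‿cong (*-assoc (s j₀) b y))) ⟨
        x * z + - (s j₀ * b * y) * z    ≈⟨ +-congˡ (*-congʳ (-‿distribˡ-* (s j₀ * b) y)) ⟩
        x * z + - (s j₀ * b) * y * z    ≈⟨ +-congˡ (*-assoc (- (s j₀ * b)) y z) ⟩
        x * z + - (s j₀ * b) * (y * z)  ∎

  NontrivialRelation : ∀ {N} → List (Fin N → Carrier) → Set
  NontrivialRelation {N} rows = ∃ λ (c : Fin N → Carrier) →
    (∃ λ j → ¬ c j ≈ 0#) × All (λ r → sum (λ j → r j * c j) ≈ 0#) rows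

  -- Gaussian elimination for a homogeneous system with fewer equations than unknowns. Each round
  -- spends one equation and at most one unknown. The search for a pivot is undecidable, hence the
  -- double negation.
  nontrivial-relation : ∀ m {N} (rows : List (Fin N → Carrier)) →
    length rows ≡ m → m ℕ.< N → ¬ ¬ NontrivialRelation rows
  nontrivial-relation zero    {suc N} [] _ _ K = K ((λ _ → 1#) , (zero , 1≉0) , [])
  nontrivial-relation (suc m) {suc N} (r ∷ rows) eq (ℕ.s≤s m<N) K =
    ¬¬-excluded-middle {A = ∃ λ j → ¬ r j ≈ 0#} λ
    { (yes (j₀ , rj₀≉0)) → invertible (r j₀) rj₀≉0 λ (b , rb≈1) →
        nontrivial-relation m (List.map (eliminate j₀ r b) rows)
          (≡.trans (List.length-map (eliminate j₀ r b) rows) (ℕ.suc-injective eq)) m<N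
          λ (c , (j , cj≉0) , c⊥rows) → K
            ( extended j₀ r b c
            , (punchIn j₀ j , cj≉0 ∘ trans (sym (reflexive (insertAt-punchIn c j₀ _ j))))
            , (begin
                sum (λ j → r j * extended j₀ r b c j)
                  ≈⟨ sum-extended j₀ r b c r ⟩
                rest j₀ r b c r - r j₀ * (b * rest j₀ r b c r)
                  ≈⟨ +-congˡ (-‿cong (trans (sym (*-assoc _ _ _))
                       (trans (*-congʳ rb≈1) (*-identityˡ _)))) ⟩
                rest j₀ r b c r - rest j₀ r b c r
                  ≈⟨ -‿inverseʳ _ ⟩
                0# ∎)
            ∷ All.map
                (λ {s} → trans (trans (sum-extended j₀ r b c s) (sym (sum-eliminate j₀ r b c s))))
                (All.map⁻ c⊥rows))
    -- Without a pivot the row is zero by stability. Every vector satisfies it, and no unknown is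
    -- spent.
    ; (no r≈0) → nontrivial-relation m rows (ℕ.suc-injective eq) (ℕ.m≤n⇒m≤1+n m<N)
        λ (c , c≉0 , c⊥rows) → K (c , c≉0 ,
          sum-zero _ (λ j → trans (*-congʳ (stable _ _ λ rj≉0 → r≈0 (j , rj≉0))) (zeroˡ (c j)))
          ∷ c⊥rows)
    }

  -- A maximum over the nonzero coefficients cannot be computed, so the proof climbs from one of
  -- them to a heavier one for as long as there is any.
  leading : ∀ {N} (c : Fin N → Carrier) (weight : Fin N → ℕ) {k} → (∀ j → weight j ≤ k) →
    (∃ λ j → ¬ c j ≈ 0#) →
    ¬ ¬ ∃ λ s → ¬ c s ≈ 0# × (∀ j → weight s ℕ.< weight j → c j ≈ 0#)
  leading {N} c weight {k} bounded (j , cj≉0) = climb k j (ℕ.m≤m+n k (weight j)) cj≉0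
    where
    -- `m` bounds the remaining ascents, since each raises the weight and no weight exceeds `k`. At
    -- `m = 0` nothing heavier is left.
    climb : ∀ m s → k ≤ m ℕ.+ weight s → ¬ c s ≈ 0# →
      ¬ ¬ ∃ λ s → ¬ c s ≈ 0# × (∀ j → weight s ℕ.< weight j → c j ≈ 0#)
    climb zero    s k≤ cs≉0 K = K (s , cs≉0 , λ j s<j →
      contradiction (ℕ.≤-trans (bounded j) k≤) (ℕ.<⇒≱ s<j))
    climb (suc m) s k≤ cs≉0 K =
      ¬¬-excluded-middle {A = ∃ λ j → weight s ℕ.< weight j × ¬ c j ≈ 0#} λ
      { (yes (j , s<j , cj≉0)) → climb m j
          (ℕ.≤-trans k≤ (ℕ.≤-trans (ℕ.≤-reflexive (≡.sym (ℕ.+-suc m (weight s))))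
            (ℕ.+-monoʳ-≤ m s<j)))
          cj≉0 K
      ; (no top) → K (s , cs≉0 , λ j s<j → stable _ _ λ cj≉0 → top (j , s<j , cj≉0))
      }

  -- Dividing a nontrivial relation by its heaviest nonzero coefficient solves for that column. The
  -- coefficients of heavier columns were zero and stay zero.
  leading-dependence : ∀ {N} (rows : List (Fin (suc N) → Carrier)) → length rows ℕ.< suc N →
    (weight : Fin (suc N) → ℕ) {k : ℕ} → (∀ j → weight j ≤ k) →
    ¬ ¬ ∃₂ λ (s : Fin (suc N)) (a : Fin N → Carrier) →
      (∀ j → weight s ℕ.< weight (punchIn s j) → a j ≈ 0#) ×
      All (λ r → r s ≈ sum (λ j → a j * r (punchIn s j))) rows
  leading-dependence {N} rows rows<N weight bounded K =
    nontrivial-relation (length rows) rows ≡.refl rows<N λ (c , c≉0 , c⊥rows) →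
    leading c weight bounded c≉0 λ (s , cs≉0 , top) →
    invertible (c s) cs≉0 λ (b , cb≈1) →
    K (s , (λ j → - b * c (punchIn s j)) ,
       (λ j s<j → trans (*-congˡ (top (punchIn s j) s<j)) (zeroʳ (- b))) ,
       All.map (λ {r} → solved s c b cb≈1 r) c⊥rows)
    where
    solved : ∀ s (c : Fin (suc N) → Carrier) b → c s * b ≈ 1# → ∀ r → sum (λ j → r j * c j) ≈ 0# →
      r s ≈ sum (λ j → - b * c (punchIn s j) * r (punchIn s j))
    solved s c b cb≈1 r c⊥r = begin
      r s                     ≈⟨ *-identityʳ (r s) ⟨
      r s * 1#                ≈⟨ *-congˡ cb≈1 ⟨
      r s * (c s * b)         ≈⟨ *-assoc (r s) (c s) b ⟨
      r s * c s * b           ≈⟨ *-congʳ (+-inverseˡ-unique (r s * c s) T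
                                   (trans (sym (sum-removeAt-product s r c)) c⊥r)) ⟩
      - T * b                 ≈⟨ -‿distribˡ-* T b ⟨
      - (T * b)               ≈⟨ -‿distribʳ-* T b ⟩
      T * - b                 ≈⟨ *-comm T (- b) ⟩
      - b * T                 ≈⟨ *-distribˡ-sum (- b) (λ j → r (punchIn s j) * c (punchIn s j)) ⟩
      sum (λ j → - b * (r (punchIn s j) * c (punchIn s j)))
        ≈⟨ sum-cong-≋ (λ j → trans (*-congˡ (*-comm (r (punchIn s j)) (c (punchIn s j))))
             (sym (*-assoc (- b) _ _))) ⟩
      sum (λ j → - b * c (punchIn s j) * r (punchIn s j)) ∎
      where
      T : Carrier
      T = sum (λ j → r (punchIn s j) * c (punchIn s j))

open ≡ using (refl; sym; trans; cong; cong₂; subst; module ≡-Reasoning)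

-- Real numbers

eventually-× : ∀ {P Q} → Eventually P → Eventually Q → Eventually λ n → P n × Q n
eventually-× (M , p) (N , q) = M ℕ.⊔ N , λ n n≥ →
  p n (ℕ.m⊔n≤o⇒m≤o M N n≥) , q n (ℕ.m⊔n≤o⇒n≤o M N n≥)

eventually-map : ∀ {P Q : ℕ → Set} → (∀ {n} → P n → Q n) → Eventually P → Eventually Q
eventually-map f (N , p) = N , λ n n≥ → f (p n n≥)

eventually-⊥ : ¬ Eventually (λ _ → ⊥)
eventually-⊥ (N , p) = p N ℕ.≤-refl

<⇒≱ℚ : ∀ {p q} → p ℚ.< q → ¬ q ℚ.≤ p
<⇒≱ℚ p<q q≤p = ℚ.<-irrefl refl (ℚ.<-≤-trans p<q q≤p)

abstract

  half≤ : ∀ {ε} → 0ℚ ℚ.< ε → ½ ℚ.* ε ℚ.≤ ε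
  half≤ {ε} 0<ε = begin
    ½ ℚ.* ε              ≡⟨ ℚ.+-identityʳ (½ ℚ.* ε) ⟨
    ½ ℚ.* ε ℚ.+ 0ℚ       ≤⟨ ℚ.+-monoʳ-≤ (½ ℚ.* ε) (ℚ.<⇒≤ (half-pos 0<ε)) ⟩
    ½ ℚ.* ε ℚ.+ ½ ℚ.* ε  ≡⟨ halves ε ⟩
    ε                    ∎
    where open ℚ.≤-Reasoning

  ∣p-q∣≡∣q-p∣ : ∀ p q → ℚ.∣ p ℚ.- q ∣ ≡ ℚ.∣ q ℚ.- p ∣
  ∣p-q∣≡∣q-p∣ p q = trans (sym (ℚ.∣-p∣≡∣p∣ (p ℚ.- q)))
    (cong ℚ.∣_∣ (solve 2 (λ p q → :- (p :- q) := q :- p) refl p q))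

  triangle : ∀ p q r → ℚ.∣ p ℚ.- r ∣ ℚ.≤ ℚ.∣ p ℚ.- q ∣ ℚ.+ ℚ.∣ q ℚ.- r ∣
  triangle p q r = subst (λ s → ℚ.∣ s ∣ ℚ.≤ ℚ.∣ p ℚ.- q ∣ ℚ.+ ℚ.∣ q ℚ.- r ∣)
    (solve 3 (λ p q r → (p :- q) :+ (q :- r) := p :- r) refl p q r)
    (ℚ.∣p+q∣≤∣p∣+∣q∣ (p ℚ.- q) (q ℚ.- r))

  p-0≡p : ∀ p → p ℚ.- 0ℚ ≡ p
  p-0≡p p = ℚ.+-identityʳ p

  -- A Cauchy sequence not bounded away from 0 is null: at an index past its
  -- modulus for ε/4, comparing with ε/2 decides between the two.
  null-unless-apart : ∀ {z} → Cauchy z →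
    ¬ (∃ λ η → 0ℚ ℚ.< η × Eventually λ n → η ℚ.≤ ℚ.∣ z n ∣) →
    ∀ ε → 0ℚ ℚ.< ε → Eventually λ n → ℚ.∣ z n ∣ ℚ.< ε
  null-unless-apart {z} cz ¬apart ε 0<ε with cz (½ ℚ.* (½ ℚ.* ε)) (half-pos (half-pos 0<ε))
  ... | N , close with ℚ.∣ z N ∣ ℚ.<? ½ ℚ.* ε
  ...   | yes small = N , λ n n≥ → begin-strict
      ℚ.∣ z n ∣                         ≡⟨ cong ℚ.∣_∣ (p-0≡p (z n)) ⟨
      ℚ.∣ z n ℚ.- 0ℚ ∣                  ≤⟨ triangle (z n) (z N) 0ℚ ⟩
      ℚ.∣ z n ℚ.- z N ∣ ℚ.+ ℚ.∣ z N ℚ.- 0ℚ ∣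
        <⟨ ℚ.+-mono-< (close n N n≥ ℕ.≤-refl)
                      (subst (λ p → ℚ.∣ p ∣ ℚ.< _) (sym (p-0≡p (z N))) small) ⟩
      η ℚ.+ ½ ℚ.* ε                     ≤⟨ ℚ.+-monoˡ-≤ (½ ℚ.* ε) (half≤ (half-pos 0<ε)) ⟩
      ½ ℚ.* ε ℚ.+ ½ ℚ.* ε               ≡⟨ halves ε ⟩
      ε                                 ∎
    where
    open ℚ.≤-Reasoning
    η : ℚ
    η = ½ ℚ.* (½ ℚ.* ε)
  ...   | no large = ⊥-elim (¬apart (η , half-pos (half-pos 0<ε) , N , λ n n≥ →
      ℚ.≮⇒≥ λ zn<η → large (begin-strict
        ℚ.∣ z N ∣                         ≡⟨ cong ℚ.∣_∣ (p-0≡p (z N)) ⟨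
        ℚ.∣ z N ℚ.- 0ℚ ∣                  ≤⟨ triangle (z N) (z n) 0ℚ ⟩
        ℚ.∣ z N ℚ.- z n ∣ ℚ.+ ℚ.∣ z n ℚ.- 0ℚ ∣
          <⟨ ℚ.+-mono-< (close N n ℕ.≤-refl n≥)
                        (subst (λ p → ℚ.∣ p ∣ ℚ.< _) (sym (p-0≡p (z n))) zn<η) ⟩
        η ℚ.+ η                           ≡⟨ halves (½ ℚ.* ε) ⟩
        ½ ℚ.* ε                           ∎)))
    where
    open ℚ.≤-Reasoning
    η : ℚ
    η = ½ ℚ.* (½ ℚ.* ε)

≈ᴿ-pointwise : ∀ x y → (∀ n → seq x n ≡ seq y n) → x ≈ᴿ y
≈ᴿ-pointwise x y eq ε 0<ε = 0 , λ n _ → subst (λ p → ℚ.∣ p ∣ ℚ.< ε)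
  (sym (trans (cong (ℚ._- seq y n) (eq n)) (ℚ.+-inverseʳ (seq y n)))) 0<ε

≈ᴿ-refl : ∀ x → x ≈ᴿ x
≈ᴿ-refl x = ≈ᴿ-pointwise x x λ _ → refl

≈ᴿ-sym : ∀ x y → x ≈ᴿ y → y ≈ᴿ x
≈ᴿ-sym x y x≈y ε 0<ε = eventually-map
  (λ {n} → subst (ℚ._< ε) (∣p-q∣≡∣q-p∣ (seq x n) (seq y n))) (x≈y ε 0<ε)

≈ᴿ-trans : ∀ x y z → x ≈ᴿ y → y ≈ᴿ z → x ≈ᴿ z
≈ᴿ-trans x y z x≈y y≈z ε 0<ε = eventually-map
  (λ {n} (p , q) → subst (_ ℚ.<_) (halves ε)
    (ℚ.≤-<-trans (triangle (seq x n) (seq y n) (seq z n)) (ℚ.+-mono-< p q)))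
  (eventually-× (x≈y _ (half-pos 0<ε)) (y≈z _ (half-pos 0<ε)))

-- A difference bounded away from 0 would refute `x ≈ᴿ y`. Since that is excluded,
-- `null-unless-apart` makes the difference null.
≈ᴿ-stable : ∀ x y → ¬ ¬ (x ≈ᴿ y) → x ≈ᴿ y
≈ᴿ-stable x y ¬¬x≈y = null-unless-apart (cauchy (x -ᴿ y)) λ (η , 0<η , far) →
  ¬¬x≈y λ x≈y → eventually-⊥ (eventually-map (λ (p , q) → <⇒≱ℚ q p)
    (eventually-× far (x≈y η 0<η)))

+ᴿ-cong : ∀ x x′ y y′ → x ≈ᴿ x′ → y ≈ᴿ y′ → x +ᴿ y ≈ᴿ x′ +ᴿ y′
+ᴿ-cong x x′ y y′ x≈x′ y≈y′ ε 0<ε = eventually-map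
  (λ {n} (p , q) → begin-strict
    ℚ.∣ (seq x n ℚ.+ seq y n) ℚ.- (seq x′ n ℚ.+ seq y′ n) ∣
      ≡⟨ cong ℚ.∣_∣ (solve 4 (λ a b c d → (a :+ b) :- (c :+ d) := (a :- c) :+ (b :- d)) refl
           (seq x n) (seq y n) (seq x′ n) (seq y′ n)) ⟩
    ℚ.∣ (seq x n ℚ.- seq x′ n) ℚ.+ (seq y n ℚ.- seq y′ n) ∣
      ≤⟨ ℚ.∣p+q∣≤∣p∣+∣q∣ (seq x n ℚ.- seq x′ n) (seq y n ℚ.- seq y′ n) ⟩
    ℚ.∣ seq x n ℚ.- seq x′ n ∣ ℚ.+ ℚ.∣ seq y n ℚ.- seq y′ n ∣
      <⟨ ℚ.+-mono-< p q ⟩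
    ½ ℚ.* ε ℚ.+ ½ ℚ.* ε
      ≡⟨ halves ε ⟩
    ε ∎)
  (eventually-× (x≈x′ _ (half-pos 0<ε)) (y≈y′ _ (half-pos 0<ε)))
  where open ℚ.≤-Reasoning

-ᴿ-cong : ∀ x y → x ≈ᴿ y → -ᴿ x ≈ᴿ -ᴿ y
-ᴿ-cong x y x≈y ε 0<ε = eventually-map
  (λ {n} → subst (ℚ._< ε) (trans (∣p-q∣≡∣q-p∣ (seq x n) (seq y n))
    (cong ℚ.∣_∣ (solve 2 (λ a b → b :- a := :- a :- :- b) refl (seq x n) (seq y n)))))
  (x≈y ε 0<ε)

*ᴿ-congˡ : ∀ x y y′ → y ≈ᴿ y′ → x *ᴿ y ≈ᴿ x *ᴿ y′
*ᴿ-congˡ x y y′ y≈y′ ε 0<ε with eventually-bounded (cauchy x)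
... | B , 0<B , bound with scale B 0<B _ 0<ε
...   | η , 0<η , Bη≡½ε = eventually-map
  (λ {n} (p , q) → begin-strict
    ℚ.∣ seq x n ℚ.* seq y n ℚ.- seq x n ℚ.* seq y′ n ∣
      ≡⟨ cong ℚ.∣_∣ (*-distrib-minus (seq x n) (seq y n) (seq y′ n)) ⟨
    ℚ.∣ seq x n ℚ.* (seq y n ℚ.- seq y′ n) ∣
      ≡⟨ ℚ.∣p*q∣≡∣p∣*∣q∣ (seq x n) (seq y n ℚ.- seq y′ n) ⟩
    ℚ.∣ seq x n ∣ ℚ.* ℚ.∣ seq y n ℚ.- seq y′ n ∣
      <⟨ *-bound {seq x n} {seq y n ℚ.- seq y′ n} 0<B p q ⟩
    B ℚ.* η
      ≡⟨ Bη≡½ε ⟩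
    ½ ℚ.* ε
      ≤⟨ half≤ 0<ε ⟩
    ε ∎)
  (eventually-× bound (y≈y′ η 0<η))
  where open ℚ.≤-Reasoning

*ᴿ-comm : ∀ x y → x *ᴿ y ≈ᴿ y *ᴿ x
*ᴿ-comm x y = ≈ᴿ-pointwise (x *ᴿ y) (y *ᴿ x) λ n → ℚ.*-comm (seq x n) (seq y n)

*ᴿ-cong : ∀ x x′ y y′ → x ≈ᴿ x′ → y ≈ᴿ y′ → x *ᴿ y ≈ᴿ x′ *ᴿ y′
*ᴿ-cong x x′ y y′ x≈x′ y≈y′ =
  ≈ᴿ-trans (x *ᴿ y) (x *ᴿ y′) (x′ *ᴿ y′) (*ᴿ-congˡ x y y′ y≈y′)
  (≈ᴿ-trans (x *ᴿ y′) (y′ *ᴿ x) (x′ *ᴿ y′) (*ᴿ-comm x y′)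
  (≈ᴿ-trans (y′ *ᴿ x) (y′ *ᴿ x′) (x′ *ᴿ y′) (*ᴿ-congˡ y′ x x′ x≈x′) (*ᴿ-comm y′ x′)))

-- Reciprocal with the junk value 0 at 0.
recip : ℚ → ℚ
recip p with p ℚ.≟ 0ℚ
... | yes _  = 0ℚ
... | no p≢0 = ℚ.1/_ p {{ℚ.≢-nonZero p≢0}}

*-recip : ∀ {p} → p ≢ 0ℚ → p ℚ.* recip p ≡ 1ℚ
*-recip {p} p≢0 with p ℚ.≟ 0ℚ
... | yes p≡0 = contradiction p≡0 p≢0
... | no p≢0′ = ℚ.*-inverseʳ p {{ℚ.≢-nonZero p≢0′}}

abstract

  apart⇒≢0 : ∀ {p η} → 0ℚ ℚ.< η → η ℚ.≤ ℚ.∣ p ∣ → p ≢ 0ℚ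
  apart⇒≢0 0<η η≤p refl = <⇒≱ℚ 0<η η≤p

  recip-bound : ∀ {p η B} → 0ℚ ℚ.< η → η ℚ.≤ ℚ.∣ p ∣ → B ℚ.* η ≡ 1ℚ → 0ℚ ℚ.< B → ℚ.∣ recip p ∣ ℚ.≤ B
  recip-bound {p} {η} {B} 0<η η≤p Bη 0<B = begin
      ℚ.∣ u ∣                       ≡⟨ ℚ.*-identityˡ ℚ.∣ u ∣ ⟨
      1ℚ ℚ.* ℚ.∣ u ∣                ≡⟨ cong (ℚ._* ℚ.∣ u ∣) Bη ⟨
      (B ℚ.* η) ℚ.* ℚ.∣ u ∣         ≤⟨ ℚ.*-monoʳ-≤-nonNeg ℚ.∣ u ∣ (ℚ.*-monoˡ-≤-nonNeg B η≤p) ⟩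
      (B ℚ.* ℚ.∣ p ∣) ℚ.* ℚ.∣ u ∣   ≡⟨ ℚ.*-assoc B ℚ.∣ p ∣ ℚ.∣ u ∣ ⟩
      B ℚ.* (ℚ.∣ p ∣ ℚ.* ℚ.∣ u ∣)   ≡⟨ cong (B ℚ.*_) (ℚ.∣p*q∣≡∣p∣*∣q∣ p u) ⟨
      B ℚ.* ℚ.∣ p ℚ.* u ∣           ≡⟨ cong (λ r → B ℚ.* ℚ.∣ r ∣) (*-recip (apart⇒≢0 0<η η≤p)) ⟩
      B ℚ.* 1ℚ                      ≡⟨ ℚ.*-identityʳ B ⟩
      B                             ∎
    where
    open ℚ.≤-Reasoning
    u : ℚ
    u = recip p
    instance
      u-nonNeg : ℚ.NonNegative ℚ.∣ u ∣
      u-nonNeg = ℚ.∣-∣-nonNeg u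
      B-nonNeg : ℚ.NonNegative B
      B-nonNeg = ℚ.nonNegative (ℚ.<⇒≤ 0<B)

  recip-minus : ∀ {p q} → p ≢ 0ℚ → q ≢ 0ℚ →
    recip p ℚ.- recip q ≡ recip p ℚ.* (recip q ℚ.* (q ℚ.- p))
  recip-minus {p} {q} p≢0 q≢0 = sym (trans
    (solve 4 (λ p q u w → u :* (w :* (q :- p)) := u :* (q :* w) :- (p :* u) :* w) refl
      p q (recip p) (recip q))
    (trans (cong₂ (λ a b → recip p ℚ.* a ℚ.- b ℚ.* recip q) (*-recip q≢0) (*-recip p≢0))
      (cong₂ ℚ._-_ (ℚ.*-identityʳ (recip p)) (ℚ.*-identityˡ (recip q)))))

  -- By `recip-minus` a difference of reciprocals is a difference of terms times two reciprocals,
  -- each at most 1/η in absolute value. The tolerance is therefore scaled down by this bound twice.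
  recip-cauchy : ∀ {x η} → Cauchy x → 0ℚ ℚ.< η → (Eventually λ n → η ℚ.≤ ℚ.∣ x n ∣) →
    Cauchy (recip ∘ x)
  recip-cauchy {x} {η} cx 0<η (L , far) ε 0<ε
    -- `scale` halves its target, so the target 2 gives `η * B = 1`.
    with scale η 0<η (1ℚ ℚ.+ 1ℚ) (ℚ.+-mono-< (ℚ.positive⁻¹ 1ℚ) (ℚ.positive⁻¹ 1ℚ))
  ... | B , 0<B , ηB with scale B 0<B ε 0<ε
  ... | ζ , 0<ζ , Bζ with scale B 0<B ζ 0<ζ
  ... | ξ , 0<ξ , Bξ with cx ξ 0<ξ
  ... | N , close = L ℕ.⊔ N , λ m n m≥ n≥ →
    let
      farm = far m (ℕ.m⊔n≤o⇒m≤o L N m≥)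
      farn = far n (ℕ.m⊔n≤o⇒m≤o L N n≥)
      u = recip (x m)
      w = recip (x n)
      d = x n ℚ.- x m
      bound : ∀ {p} → η ℚ.≤ ℚ.∣ p ∣ → ℚ.∣ recip p ∣ ℚ.≤ B
      bound η≤p = recip-bound 0<η η≤p (trans (ℚ.*-comm B η) ηB) 0<B
    in begin-strict
      ℚ.∣ u ℚ.- w ∣
        ≡⟨ cong ℚ.∣_∣ (recip-minus (apart⇒≢0 0<η farm) (apart⇒≢0 0<η farn)) ⟩
      ℚ.∣ u ℚ.* (w ℚ.* d) ∣
        ≡⟨ ℚ.∣p*q∣≡∣p∣*∣q∣ u (w ℚ.* d) ⟩
      ℚ.∣ u ∣ ℚ.* ℚ.∣ w ℚ.* d ∣
        <⟨ *-bound {u} {w ℚ.* d} 0<B (bound farm) (begin-strict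
             ℚ.∣ w ℚ.* d ∣             ≡⟨ ℚ.∣p*q∣≡∣p∣*∣q∣ w d ⟩
             ℚ.∣ w ∣ ℚ.* ℚ.∣ d ∣       <⟨ *-bound {w} {d} 0<B (bound farn)
                                            (close n m (ℕ.m⊔n≤o⇒n≤o L N n≥) (ℕ.m⊔n≤o⇒n≤o L N m≥)) ⟩
             B ℚ.* ξ                   ≡⟨ Bξ ⟩
             ½ ℚ.* ζ                   ≤⟨ half≤ 0<ζ ⟩
             ζ                         ∎) ⟩
      B ℚ.* ζ
        ≡⟨ Bζ ⟩
      ½ ℚ.* ε
        ≤⟨ half≤ 0<ε ⟩
      ε ∎
    where
    open ℚ.≤-Reasoning

-- Being nonzero does not exhibit a lower bound on the absolute value. If no inverse existed, no
-- such bound could exist either, and `null-unless-apart` would make `x` zero.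
≉0⇒invertibleᴿ : ∀ x → ¬ x ≈ᴿ 0ᴿ → ¬ ¬ ∃ λ y → x *ᴿ y ≈ᴿ 1ᴿ
≉0⇒invertibleᴿ x x≉0 ¬inv = x≉0 (null-unless-apart (cauchy (x -ᴿ 0ᴿ)) λ (η , 0<η , far-) →
  let
    far : Eventually λ n → η ℚ.≤ ℚ.∣ seq x n ∣
    far = eventually-map (λ {n} → subst (λ p → η ℚ.≤ ℚ.∣ p ∣) (p-0≡p (seq x n))) far-
  in ¬inv (mkℝ (recip ∘ seq x) (recip-cauchy (cauchy x) 0<η far) , λ ε 0<ε →
    eventually-map (λ η≤x → subst (λ p → ℚ.∣ p ℚ.- 1ℚ ∣ ℚ.< ε)
      (sym (*-recip (apart⇒≢0 0<η η≤x))) 0<ε) far))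

-- Complex numbers

-ᶜ_ : ℂ → ℂ
-ᶜ (a +i b) = (-ᴿ a) +i (-ᴿ b)

≈ᶜ-pointwise : ∀ z w → (∀ n → seq (re z) n ≡ seq (re w) n) →
  (∀ n → seq (im z) n ≡ seq (im w) n) → z ≈ᶜ w
≈ᶜ-pointwise z w p q = ≈ᴿ-pointwise (re z) (re w) p , ≈ᴿ-pointwise (im z) (im w) q

≈ᶜ-stable : ∀ z w → ¬ ¬ (z ≈ᶜ w) → z ≈ᶜ w
≈ᶜ-stable z w ¬¬eq =
  ≈ᴿ-stable (re z) (re w) (λ ne → ¬¬eq (ne ∘ proj₁)) ,
  ≈ᴿ-stable (im z) (im w) (λ ne → ¬¬eq (ne ∘ proj₂))

+ᶜ-cong : ∀ z z′ w w′ → z ≈ᶜ z′ → w ≈ᶜ w′ → z +ᶜ w ≈ᶜ z′ +ᶜ w′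
+ᶜ-cong (a +i b) (a′ +i b′) (c +i d) (c′ +i d′) (a≈ , b≈) (c≈ , d≈) =
  +ᴿ-cong a a′ c c′ a≈ c≈ , +ᴿ-cong b b′ d d′ b≈ d≈

*ᶜ-cong : ∀ z z′ w w′ → z ≈ᶜ z′ → w ≈ᶜ w′ → z *ᶜ w ≈ᶜ z′ *ᶜ w′
*ᶜ-cong (a +i b) (a′ +i b′) (c +i d) (c′ +i d′) (a≈ , b≈) (c≈ , d≈) =
  +ᴿ-cong (a *ᴿ c) (a′ *ᴿ c′) (-ᴿ (b *ᴿ d)) (-ᴿ (b′ *ᴿ d′))
    (*ᴿ-cong a a′ c c′ a≈ c≈) (-ᴿ-cong (b *ᴿ d) (b′ *ᴿ d′) (*ᴿ-cong b b′ d d′ b≈ d≈)) ,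
  +ᴿ-cong (a *ᴿ d) (a′ *ᴿ d′) (b *ᴿ c) (b′ *ᴿ c′)
    (*ᴿ-cong a a′ d d′ a≈ d≈) (*ᴿ-cong b b′ c c′ b≈ c≈)

abstract

  *ᶜ-assoc : ∀ x y z → (x *ᶜ y) *ᶜ z ≈ᶜ x *ᶜ (y *ᶜ z)
  *ᶜ-assoc x@(a +i b) y@(c +i d) z@(e +i f) = ≈ᶜ-pointwise ((x *ᶜ y) *ᶜ z) (x *ᶜ (y *ᶜ z))
    (λ n → solve 6 (λ a b c d e f →
        (a :* c :- b :* d) :* e :- (a :* d :+ b :* c) :* f
      := a :* (c :* e :- d :* f) :- b :* (c :* f :+ d :* e)) refl
      (seq a n) (seq b n) (seq c n) (seq d n) (seq e n) (seq f n))
    (λ n → solve 6 (λ a b c d e f →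
        (a :* c :- b :* d) :* f :+ (a :* d :+ b :* c) :* e
      := a :* (c :* f :+ d :* e) :+ b :* (c :* e :- d :* f)) refl
      (seq a n) (seq b n) (seq c n) (seq d n) (seq e n) (seq f n))

  *ᶜ-distribˡ : ∀ x y z → x *ᶜ (y +ᶜ z) ≈ᶜ x *ᶜ y +ᶜ x *ᶜ z
  *ᶜ-distribˡ x@(a +i b) y@(c +i d) z@(e +i f) = ≈ᶜ-pointwise (x *ᶜ (y +ᶜ z)) (x *ᶜ y +ᶜ x *ᶜ z)
    (λ n → solve 6 (λ a b c d e f →
        a :* (c :+ e) :- b :* (d :+ f) := (a :* c :- b :* d) :+ (a :* e :- b :* f)) refl
      (seq a n) (seq b n) (seq c n) (seq d n) (seq e n) (seq f n))
    (λ n → solve 6 (λ a b c d e f →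
        a :* (d :+ f) :+ b :* (c :+ e) := (a :* d :+ b :* c) :+ (a :* f :+ b :* e)) refl
      (seq a n) (seq b n) (seq c n) (seq d n) (seq e n) (seq f n))

  *ᶜ-comm : ∀ x y → x *ᶜ y ≈ᶜ y *ᶜ x
  *ᶜ-comm x@(a +i b) y@(c +i d) = ≈ᶜ-pointwise (x *ᶜ y) (y *ᶜ x)
    (λ n → solve 4 (λ a b c d → a :* c :- b :* d := c :* a :- d :* b) refl
      (seq a n) (seq b n) (seq c n) (seq d n))
    (λ n → solve 4 (λ a b c d → a :* d :+ b :* c := c :* b :+ d :* a) refl
      (seq a n) (seq b n) (seq c n) (seq d n))

  *ᶜ-identityˡ : ∀ x → 1ᶜ *ᶜ x ≈ᶜ x
  *ᶜ-identityˡ x@(a +i b) = ≈ᶜ-pointwise (1ᶜ *ᶜ x) x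
    (λ n → solve 2 (λ a b → con 1ℚ :* a :- con 0ℚ :* b := a) refl (seq a n) (seq b n))
    (λ n → solve 2 (λ a b → con 1ℚ :* b :+ con 0ℚ :* a := b) refl (seq a n) (seq b n))

≈ᶜ-refl : ∀ z → z ≈ᶜ z
≈ᶜ-refl z = ≈ᴿ-refl (re z) , ≈ᴿ-refl (im z)

≈ᶜ-sym : ∀ z w → z ≈ᶜ w → w ≈ᶜ z
≈ᶜ-sym z w (p , q) = ≈ᴿ-sym (re z) (re w) p , ≈ᴿ-sym (im z) (im w) q

≈ᶜ-trans : ∀ x y z → x ≈ᶜ y → y ≈ᶜ z → x ≈ᶜ z
≈ᶜ-trans x y z (p , q) (p′ , q′) =
  ≈ᴿ-trans (re x) (re y) (re z) p p′ , ≈ᴿ-trans (im x) (im y) (im z) q q′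

+ᶜ-comm : ∀ x y → x +ᶜ y ≈ᶜ y +ᶜ x
+ᶜ-comm x y = ≈ᶜ-pointwise (x +ᶜ y) (y +ᶜ x)
  (λ n → ℚ.+-comm (seq (re x) n) (seq (re y) n))
  (λ n → ℚ.+-comm (seq (im x) n) (seq (im y) n))

+ᶜ-identityˡ : ∀ x → 0ᶜ +ᶜ x ≈ᶜ x
+ᶜ-identityˡ x = ≈ᶜ-pointwise (0ᶜ +ᶜ x) x
  (λ n → ℚ.+-identityˡ (seq (re x) n)) (λ n → ℚ.+-identityˡ (seq (im x) n))

-ᶜ-inverseˡ : ∀ x → (-ᶜ x) +ᶜ x ≈ᶜ 0ᶜ
-ᶜ-inverseˡ x = ≈ᶜ-pointwise ((-ᶜ x) +ᶜ x) 0ᶜ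
  (λ n → ℚ.+-inverseˡ (seq (re x) n)) (λ n → ℚ.+-inverseˡ (seq (im x) n))

-- _≈ᶜ_ unfolds, so unification cannot recover its two sides; the wrapped
-- relation determines them.
infix 4 _≃_

record _≃_ (z w : ℂ) : Set where
  constructor wrap
  field unwrap : z ≈ᶜ w

open _≃_ public

ℂ-commutativeRing : CommutativeRing 0ℓ 0ℓ
ℂ-commutativeRing = record
  { Carrier = ℂ ; _≈_ = _≃_ ; _+_ = _+ᶜ_ ; _*_ = _*ᶜ_ ; -_ = -ᶜ_ ; 0# = 0ᶜ ; 1# = 1ᶜ
  ; isCommutativeRing = record
    { isRing = record
      { +-isAbelianGroup = record
        { isGroup = record
          { isMonoid = record
            { isSemigroup = record
              { isMagma = record
                { isEquivalence = ≃-isEquivalence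
                ; ∙-cong = +-cong
                }
              ; assoc = λ x y z → wrap (≈ᶜ-pointwise ((x +ᶜ y) +ᶜ z) (x +ᶜ (y +ᶜ z))
                  (λ n → ℚ.+-assoc (seq (re x) n) (seq (re y) n) (seq (re z) n))
                  (λ n → ℚ.+-assoc (seq (im x) n) (seq (im y) n) (seq (im z) n)))
              }
            ; identity = comm∧idˡ⇒id +-comm +-identityˡ
            }
          ; inverse = comm∧invˡ⇒inv +-comm -‿inverseˡ
          ; ⁻¹-cong = λ {z} {w} (wrap (p , q)) →
              wrap (-ᴿ-cong (re z) (re w) p , -ᴿ-cong (im z) (im w) q)
          }
        ; comm = +-comm
        }
      ; *-cong = *-cong
      ; *-assoc = λ x y z → wrap (*ᶜ-assoc x y z)
      ; *-identity = comm∧idˡ⇒id *-comm λ x → wrap (*ᶜ-identityˡ x)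
      ; distrib = comm∧distrˡ⇒distr +-cong *-comm λ x y z → wrap (*ᶜ-distribˡ x y z)
      }
    ; *-comm = *-comm
    }
  }
  where
  ≃-isEquivalence : IsEquivalence _≃_
  ≃-isEquivalence = record
    { refl  = λ {x} → wrap (≈ᶜ-refl x)
    ; sym   = λ {x} {y} (wrap p) → wrap (≈ᶜ-sym x y p)
    ; trans = λ {x} {y} {z} (wrap p) (wrap q) → wrap (≈ᶜ-trans x y z p q)
    }
  ≃-setoid : Setoid 0ℓ 0ℓ
  ≃-setoid = record { isEquivalence = ≃-isEquivalence }
  open Consequences ≃-setoid
  open Algebra.Definitions _≃_
  +-cong : Congruent₂ _+ᶜ_
  +-cong {x} {y} {z} {w} (wrap p) (wrap q) = wrap (+ᶜ-cong x y z w p q)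
  *-cong : Congruent₂ _*ᶜ_
  *-cong {x} {y} {z} {w} (wrap p) (wrap q) = wrap (*ᶜ-cong x y z w p q)
  +-comm : Commutative _+ᶜ_
  +-comm x y = wrap (+ᶜ-comm x y)
  *-comm : Commutative _*ᶜ_
  *-comm x y = wrap (*ᶜ-comm x y)
  +-identityˡ : LeftIdentity 0ᶜ _+ᶜ_
  +-identityˡ x = wrap (+ᶜ-identityˡ x)
  -‿inverseˡ : LeftInverse 0ᶜ -ᶜ_ _+ᶜ_
  -‿inverseˡ x = wrap (-ᶜ-inverseˡ x)

-- Inverses of complex numbers

abstract

  ∣p∣∣p∣≡pp : ∀ p → ℚ.∣ p ∣ ℚ.* ℚ.∣ p ∣ ≡ p ℚ.* p
  ∣p∣∣p∣≡pp p with ℚ.∣p∣≡p∨∣p∣≡-p p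
  ... | inj₁ eq = cong₂ ℚ._*_ eq eq
  ... | inj₂ eq = trans (cong₂ ℚ._*_ eq eq) (solve 1 (λ p → :- p :* :- p := p :* p) refl p)

  *-pos : ∀ {p q} → 0ℚ ℚ.< p → 0ℚ ℚ.< q → 0ℚ ℚ.< p ℚ.* q
  *-pos {p} {q} 0<p 0<q = subst (ℚ._< p ℚ.* q) (ℚ.*-zeroʳ p)
    (ℚ.*-monoʳ-<-pos p {{ℚ.positive 0<p}} 0<q)

  p≤∣p∣ : ∀ p → p ℚ.≤ ℚ.∣ p ∣
  p≤∣p∣ p with ℚ.≤-total 0ℚ p
  ... | inj₁ 0≤p = ℚ.≤-reflexive (sym (ℚ.0≤p⇒∣p∣≡p 0≤p))
  ... | inj₂ p≤0 = ℚ.≤-trans p≤0 (ℚ.0≤∣p∣ p)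

  -- By contraposition: ε ≤ ∣a∣ gives ε² ≤ a² ≤ a² + b².
  sum-of-squares-small : ∀ {a b ε} → 0ℚ ℚ.< ε →
    ℚ.∣ (a ℚ.* a ℚ.+ b ℚ.* b) ℚ.- 0ℚ ∣ ℚ.< ε ℚ.* ε → ℚ.∣ a ℚ.- 0ℚ ∣ ℚ.< ε
  sum-of-squares-small {a} {b} {ε} 0<ε small = ℚ.≰⇒> λ ε≤a → <⇒≱ℚ small (begin
      ε ℚ.* ε                             ≤⟨ ℚ.*-monoˡ-≤-nonNeg ε (ε≤∣a∣ ε≤a) ⟩
      ε ℚ.* ℚ.∣ a ∣                       ≤⟨ ℚ.*-monoʳ-≤-nonNeg ℚ.∣ a ∣ (ε≤∣a∣ ε≤a) ⟩
      ℚ.∣ a ∣ ℚ.* ℚ.∣ a ∣                 ≡⟨ ℚ.+-identityʳ (ℚ.∣ a ∣ ℚ.* ℚ.∣ a ∣) ⟨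
      ℚ.∣ a ∣ ℚ.* ℚ.∣ a ∣ ℚ.+ 0ℚ          ≤⟨ ℚ.+-monoʳ-≤ (ℚ.∣ a ∣ ℚ.* ℚ.∣ a ∣) 0≤bb ⟩
      ℚ.∣ a ∣ ℚ.* ℚ.∣ a ∣ ℚ.+ ℚ.∣ b ∣ ℚ.* ℚ.∣ b ∣
        ≡⟨ cong₂ ℚ._+_ (∣p∣∣p∣≡pp a) (∣p∣∣p∣≡pp b) ⟩
      a ℚ.* a ℚ.+ b ℚ.* b                 ≤⟨ p≤∣p∣ (a ℚ.* a ℚ.+ b ℚ.* b) ⟩
      ℚ.∣ a ℚ.* a ℚ.+ b ℚ.* b ∣           ≡⟨ cong ℚ.∣_∣ (p-0≡p (a ℚ.* a ℚ.+ b ℚ.* b)) ⟨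
      ℚ.∣ (a ℚ.* a ℚ.+ b ℚ.* b) ℚ.- 0ℚ ∣  ∎)
    where
    open ℚ.≤-Reasoning
    instance
      ε-nonNeg : ℚ.NonNegative ε
      ε-nonNeg = ℚ.nonNegative (ℚ.<⇒≤ 0<ε)
      a-nonNeg : ℚ.NonNegative ℚ.∣ a ∣
      a-nonNeg = ℚ.∣-∣-nonNeg a
      b-nonNeg : ℚ.NonNegative ℚ.∣ b ∣
      b-nonNeg = ℚ.∣-∣-nonNeg b
    ε≤∣a∣ : ε ℚ.≤ ℚ.∣ a ℚ.- 0ℚ ∣ → ε ℚ.≤ ℚ.∣ a ∣
    ε≤∣a∣ = subst (λ p → ε ℚ.≤ ℚ.∣ p ∣) (p-0≡p a)
    0≤bb : 0ℚ ℚ.≤ ℚ.∣ b ∣ ℚ.* ℚ.∣ b ∣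
    0≤bb = ℚ.nonNegative⁻¹ (ℚ.∣ b ∣ ℚ.* ℚ.∣ b ∣) {{ℚ.nonNeg*nonNeg⇒nonNeg ℚ.∣ b ∣ ℚ.∣ b ∣}}

norm² : ℂ → ℝ
norm² (a +i b) = a *ᴿ a +ᴿ b *ᴿ b

norm²≈0⇒≈0 : ∀ z → norm² z ≈ᴿ 0ᴿ → z ≈ᶜ 0ᶜ
norm²≈0⇒≈0 z@(a +i b) N≈0 =
  (λ ε 0<ε → eventually-map
    (λ {n} → sum-of-squares-small {seq a n} {seq b n} 0<ε)
    (N≈0 (ε ℚ.* ε) (*-pos 0<ε 0<ε))) ,
  (λ ε 0<ε → eventually-map
    (λ {n} → sum-of-squares-small {seq b n} {seq a n} 0<ε ∘
      subst (λ p → ℚ.∣ p ℚ.- 0ℚ ∣ ℚ.< ε ℚ.* ε)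
        (ℚ.+-comm (seq a n ℚ.* seq a n) (seq b n ℚ.* seq b n)))
    (N≈0 (ε ℚ.* ε) (*-pos 0<ε 0<ε)))

-- The inverse is the conjugate divided by the squared modulus.
≉0⇒invertible : ∀ z → z ≉ᶜ 0ᶜ → ¬ ¬ ∃ λ w → z *ᶜ w ≈ᶜ 1ᶜ
≉0⇒invertible z@(a +i b) z≉0 ¬inv = ≉0⇒invertibleᴿ (norm² z) (z≉0 ∘ norm²≈0⇒≈0 z)
  λ (y , Ny≈1) → ¬inv (a *ᴿ y +i (-ᴿ b) *ᴿ y ,
    ≈ᴿ-trans (a *ᴿ (a *ᴿ y) -ᴿ b *ᴿ ((-ᴿ b) *ᴿ y)) (norm² z *ᴿ y) 1ᴿ
      (≈ᴿ-pointwise (a *ᴿ (a *ᴿ y) -ᴿ b *ᴿ ((-ᴿ b) *ᴿ y)) (norm² z *ᴿ y) λ n →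
        solve 3 (λ a b y → a :* (a :* y) :- b :* (:- b :* y) := (a :* a :+ b :* b) :* y) refl
          (seq a n) (seq b n) (seq y n))
      Ny≈1 ,
    ≈ᴿ-pointwise (a *ᴿ ((-ᴿ b) *ᴿ y) +ᴿ b *ᴿ (a *ᴿ y)) 0ᴿ λ n →
      solve 3 (λ a b y → a :* (:- b :* y) :+ b :* (a :* y) := con 0ℚ) refl
        (seq a n) (seq b n) (seq y n))

-- Events of positive probability

abstract

  -- Here k = 2e, h = 4e and η = 8e. The two bounds give p ≤ 4e. In each of them one `e` is the
  -- tolerance of the limit and the other the slack in `_≤ᴿ_`.
  squeeze : ∀ {s p l e h k η} → e ℚ.+ e ≡ k → k ℚ.+ k ≡ h → h ℚ.+ h ≡ η →
    s ℚ.+ p ℚ.≤ (l ℚ.+ e) ℚ.+ e → l ℚ.≤ (s ℚ.+ e) ℚ.+ e → p ℚ.+ h ℚ.≤ η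
  squeeze {s} {p} {l} {e} {h} refl refl refl up down = begin
      p ℚ.+ h
        ≡⟨ solve 3 (λ s p h → p :+ h := (:- s :+ h) :+ (s :+ p)) refl s p h ⟩
      (ℚ.- s ℚ.+ h) ℚ.+ (s ℚ.+ p)
        ≤⟨ ℚ.+-monoʳ-≤ (ℚ.- s ℚ.+ h) (ℚ.≤-trans up (ℚ.+-monoˡ-≤ e (ℚ.+-monoˡ-≤ e down))) ⟩
      (ℚ.- s ℚ.+ h) ℚ.+ ((((s ℚ.+ e) ℚ.+ e) ℚ.+ e) ℚ.+ e)
        ≡⟨ solve 3 (λ s h e →
             (:- s :+ h) :+ ((((s :+ e) :+ e) :+ e) :+ e) := h :+ ((e :+ e) :+ (e :+ e))) refl s h e ⟩
      h ℚ.+ ((e ℚ.+ e) ℚ.+ (e ℚ.+ e)) ∎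
    where open ℚ.≤-Reasoning

  -- With δ for `d` and 1 for `u`: since e = 2h, the first two bounds give 2h ≤ u - d ≤ p + h, so h
  -- ≤ p, against p + z ≤ h.
  no-room : ∀ {d e h p u z} → h ℚ.+ h ≡ e → 0ℚ ℚ.< z →
    d ℚ.+ e ℚ.≤ u → u ℚ.- d ℚ.≤ p ℚ.+ h → ¬ p ℚ.+ z ℚ.≤ h
  no-room {d} {e} {h} {p} {u} {z} refl 0<z a b c = <⇒≱ℚ 0<z (begin
      z
        ≡⟨ solve 3 (λ z d e → z := (z :- (d :+ e)) :+ (d :+ e)) refl z d e ⟩
      (z ℚ.- (d ℚ.+ e)) ℚ.+ (d ℚ.+ e)
        ≤⟨ ℚ.+-monoʳ-≤ (z ℚ.- (d ℚ.+ e)) a ⟩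
      (z ℚ.- (d ℚ.+ e)) ℚ.+ u
        ≡⟨ solve 4 (λ z d e u → (z :- (d :+ e)) :+ u := (z :- e) :+ (u :- d)) refl z d e u ⟩
      (z ℚ.- e) ℚ.+ (u ℚ.- d)
        ≤⟨ ℚ.+-monoʳ-≤ (z ℚ.- e) b ⟩
      (z ℚ.- e) ℚ.+ (p ℚ.+ h)
        ≡⟨ solve 3 (λ z h p → (z :- (h :+ h)) :+ (p :+ h) := (p :+ z) :- h) refl z h p ⟩
      (p ℚ.+ z) ℚ.- h
        ≤⟨ ℚ.+-monoˡ-≤ (ℚ.- h) c ⟩
      h ℚ.- h
        ≡⟨ ℚ.+-inverseʳ h ⟩
      0ℚ ∎)
    where open ℚ.≤-Reasoning

-- Consecutive partial sums differ by p, and both are eventually close to l.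
converges⇒small : ∀ p l → partialSums (λ _ → p) ⟶ l → ∀ η → 0ℚ ℚ.< η → p <ᴿ fromℚ η
converges⇒small p l conv η 0<η = ½ ℚ.* η , half-pos 0<η , eventually-map
  (λ {n} (up , down) → squeeze {seq (partialSums (λ _ → p) N) n} {seq p n} {seq l n}
    (halves (½ ℚ.* (½ ℚ.* η))) (halves (½ ℚ.* η)) (halves η) up down)
  (eventually-× (proj₁ (close (suc N) (ℕ.n≤1+n N)) ε 0<ε) (proj₂ (close N ℕ.≤-refl) ε 0<ε))
  where
  ε : ℚ
  ε = ½ ℚ.* (½ ℚ.* (½ ℚ.* η))
  0<ε : 0ℚ ℚ.< ε
  0<ε = half-pos (half-pos (half-pos 0<η))
  N : ℕ
  N = proj₁ (conv ε 0<ε)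
  close : ∀ n → N ℕ.≤ n →
    partialSums (λ _ → p) n ≤ᴿ l +ᴿ fromℚ ε × l ≤ᴿ partialSums (λ _ → p) n +ᴿ fromℚ ε
  close = proj₂ (conv ε 0<ε)

module _ (P : ProbabilitySpace) where
  open ProbabilitySpace P

  -- Infinitely many copies of an empty event are pairwise disjoint, so countable additivity makes a
  -- series with constant terms converge.
  ℙ-empty-small : ∀ {E} (mE : Measurable E) → Empty E → ∀ η → 0ℚ ℚ.< η → ℙ E mE <ᴿ fromℚ η
  ℙ-empty-small {E} mE empty = converges⇒small (ℙ E mE)
    (ℙ _ (union λ _ → mE)) (ℙ-additive {λ _ → E} (λ _ → mE) λ _ ω (e , _) → empty ω e)

  -- The gap ε between δ and 1 is split in halves: one bounds the probability of an empty event, the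
  -- other is the slack in `1 - δ ≤ ℙ E`. No outcome in the event is exhibited.
  positive⇒¬Empty : ∀ {E} (mE : Measurable E) {δ} → δ <ᴿ 1ᴿ → 1ᴿ -ᴿ δ ≤ᴿ ℙ E mE → ¬ Empty E
  positive⇒¬Empty {E} mE {δ} (ε , 0<ε , δ+ε≤1) 1-δ≤p empty
    with ℙ-empty-small mE empty (½ ℚ.* ε) (half-pos 0<ε)
  ... | ζ , 0<ζ , p+ζ≤½ε = eventually-⊥ (eventually-map
      (λ {n} ((a , b) , c) → no-room {seq δ n} {p = seq (ℙ E mE) n} (halves ε) 0<ζ a b c)
      (eventually-× (eventually-× δ+ε≤1 (1-δ≤p (½ ℚ.* ε) (half-pos 0<ε))) p+ζ≤½ε))

-- Exponents and supports

SquareFree : ∀ {n} → Exponent n → Set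
SquareFree = VecAll.All (_≤ 1)

indicator-squareFree : ∀ {n} (S : Subset n) → SquareFree (indicator S)
indicator-squareFree []            = VecAll.[]
indicator-squareFree (inside  ∷ S) = ℕ.≤-refl VecAll.∷ indicator-squareFree S
indicator-squareFree (outside ∷ S) = ℕ.z≤n VecAll.∷ indicator-squareFree S

sum-indicator : ∀ {n} (S : Subset n) → Vec.sum (indicator S) ≡ ∣ S ∣
sum-indicator []            = refl
sum-indicator (inside  ∷ S) = cong suc (sum-indicator S)
sum-indicator (outside ∷ S) = sum-indicator S

sum-zipWith-+ : ∀ {n} (α β : Exponent n) → Vec.sum (zipWith ℕ._+_ α β) ≡ Vec.sum α ℕ.+ Vec.sum β
sum-zipWith-+ []      []      = refl
sum-zipWith-+ (a ∷ α) (b ∷ β) = trans (cong (a ℕ.+ b ℕ.+_) (sum-zipWith-+ α β))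
  (interchange a b (Vec.sum α) (Vec.sum β))
  where open CommutativeSemigroupProperties ℕ.+-commutativeSemigroup using (interchange)

side : Fin 2 → Side
side zero    = inside
side (suc _) = outside

side-injective : ∀ a b → side a ≡ side b → a ≡ b
side-injective zero       zero       _ = refl
side-injective (suc zero) (suc zero) _ = refl

-- The binary digits of the index serve as characteristic vector, so `Fin (2 ^ k)` enumerates all
-- subsets.
subset : ∀ k → Fin (2 ^ k) → Subset k
subset zero    _ = []
subset (suc k) i = side (proj₁ (remQuot {2} (2 ^ k) i)) ∷ subset k (proj₂ (remQuot {2} (2 ^ k) i))

subset-injective : ∀ k i j → subset k i ≡ subset k j → i ≡ j
subset-injective zero    zero zero _  = refl
subset-injective (suc k) i    j    eq = begin
  i                                  ≡⟨ Fin.combine-remQuot {2} (2 ^ k) i ⟨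
  combine (proj₁ (qr i)) (proj₂ (qr i))
    ≡⟨ cong₂ combine (side-injective _ _ (Vec.∷-injectiveˡ eq))
         (subset-injective k _ _ (Vec.∷-injectiveʳ eq)) ⟩
  combine (proj₁ (qr j)) (proj₂ (qr j))
    ≡⟨ Fin.combine-remQuot {2} (2 ^ k) j ⟩
  j ∎
  where
  open ≡-Reasoning
  qr : Fin (2 ^ suc k) → _
  qr = remQuot {2} (2 ^ k)

-- Exponents of the monomials and of their lifts

module _ (r : ℕ) where

  -- With d = k + 1, the set `S` selects among x₂, ..., x_d. The last `r = n - d` variables get
  -- exponent 0.
  padded : ∀ {k} → Subset k → Exponent (k ℕ.+ r)
  padded S = indicator (S Vec.++ ⊥ˢ {r})

  sum-padded : ∀ {k} (S : Subset k) → Vec.sum (padded S) ≡ ∣ S ∣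
  sum-padded []            = trans (sum-indicator (⊥ˢ {r})) (∣⊥∣≡0 r)
  sum-padded (inside  ∷ S) = cong suc (sum-padded S)
  sum-padded (outside ∷ S) = sum-padded S

  padded-+-∁ : ∀ {k} (S : Subset k) → zipWith ℕ._+_ (padded S) (padded (∁ S)) ≡ padded (⊤ˢ {k})
  padded-+-∁ []            = zeros r
    where
    zeros : ∀ r → zipWith ℕ._+_ (indicator (⊥ˢ {r})) (indicator (⊥ˢ {r})) ≡ indicator (⊥ˢ {r})
    zeros zero    = refl
    zeros (suc r) = cong (0 ∷_) (zeros r)
  padded-+-∁ (inside  ∷ S) = cong (1 ∷_) (padded-+-∁ S)
  padded-+-∁ (outside ∷ S) = cong (1 ∷_) (padded-+-∁ S)

  -- A variable in `T` but not in `S` would have exponent 2, so T ⊆ S.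
  disjoint-∁⇒∣∣≤ : ∀ {k} (T S : Subset k) →
    SquareFree (zipWith ℕ._+_ (padded T) (padded (∁ S))) → ∣ T ∣ ≤ ∣ S ∣
  disjoint-∁⇒∣∣≤ []            []            _              = ℕ.z≤n
  disjoint-∁⇒∣∣≤ (inside  ∷ T) (inside  ∷ S) (_ VecAll.∷ sf) = ℕ.s≤s (disjoint-∁⇒∣∣≤ T S sf)
  disjoint-∁⇒∣∣≤ (outside ∷ T) (inside  ∷ S) (_ VecAll.∷ sf) = ℕ.m≤n⇒m≤1+n (disjoint-∁⇒∣∣≤ T S sf)
  disjoint-∁⇒∣∣≤ (outside ∷ T) (outside ∷ S) (_ VecAll.∷ sf) = disjoint-∁⇒∣∣≤ T S sf
  disjoint-∁⇒∣∣≤ (inside  ∷ T) (outside ∷ S) (ℕ.s≤s () VecAll.∷ sf)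

  -- Again T ⊆ S, and now the sizes leave no room for a proper inclusion.
  disjoint-∁⇒≡ : ∀ {k} (T S : Subset k) →
    SquareFree (zipWith ℕ._+_ (padded T) (padded (∁ S))) → ∣ S ∣ ≤ ∣ T ∣ → T ≡ S
  disjoint-∁⇒≡ []            []            _               _ = refl
  disjoint-∁⇒≡ (inside  ∷ T) (inside  ∷ S) (_ VecAll.∷ sf) (ℕ.s≤s S≤T) =
    cong (inside ∷_) (disjoint-∁⇒≡ T S sf S≤T)
  disjoint-∁⇒≡ (outside ∷ T) (inside  ∷ S) (_ VecAll.∷ sf) S<T =
    contradiction (disjoint-∁⇒∣∣≤ T S sf) (ℕ.<⇒≱ S<T)
  disjoint-∁⇒≡ (outside ∷ T) (outside ∷ S) (_ VecAll.∷ sf) S≤T =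
    cong (outside ∷_) (disjoint-∁⇒≡ T S sf S≤T)
  disjoint-∁⇒≡ (inside  ∷ T) (outside ∷ S) (ℕ.s≤s () VecAll.∷ sf) _

  -- x₁^(k−∣T∣) · x^T, and for ∣T∣ ≤ ∣S∣ its multiple x₁ · x^(∁S) with x₁^(k−∣S∣)
  -- divided out.
  monomial : ∀ {k} → Subset k → Exponent (suc k ℕ.+ r)
  monomial {k} T = (k ∸ ∣ T ∣) ∷ padded T

  lifted : ∀ {k} → Subset k → Subset k → Exponent (suc k ℕ.+ r)
  lifted S T = suc (∣ S ∣ ∸ ∣ T ∣) ∷ zipWith ℕ._+_ (padded T) (padded (∁ S))

  full : ∀ k → Subset (suc k ℕ.+ r)
  full k = inside ∷ (⊤ˢ {k} Vec.++ ⊥ˢ {r})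

  ∣full∣ : ∀ k → ∣ full k ∣ ≡ suc k
  ∣full∣ k = trans (sym (sum-indicator (full k))) (cong suc (trans (sum-padded (⊤ˢ {k})) (∣⊤∣≡n k)))

  lifted-self : ∀ {k} (S : Subset k) → lifted S S ≡ indicator (full k)
  lifted-self S = cong₂ _∷_ (cong suc (ℕ.n∸n≡0 ∣ S ∣)) (padded-+-∁ S)

  -- First entry at most 1 means ∣S∣ ≤ ∣T∣, and the other entries give T ⊆ S.
  lifted-squareFree : ∀ {k} (S T : Subset k) → SquareFree (lifted S T) → T ≡ S
  lifted-squareFree S T (ℕ.s≤s S∸T≤0 VecAll.∷ sf) =
    disjoint-∁⇒≡ T S sf (ℕ.m∸n≡0⇒m≤n (ℕ.n≤0⇒n≡0 S∸T≤0))

  sum-lifted : ∀ {k} (S T : Subset k) → ∣ T ∣ ≤ ∣ S ∣ → Vec.sum (lifted S T) ≡ suc k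
  sum-lifted {k} S T T≤S = cong suc (begin
    ∣ S ∣ ∸ ∣ T ∣ ℕ.+ Vec.sum (zipWith ℕ._+_ (padded T) (padded (∁ S)))
      ≡⟨ cong (∣ S ∣ ∸ ∣ T ∣ ℕ.+_) (sum-zipWith-+ (padded T) (padded (∁ S))) ⟩
    ∣ S ∣ ∸ ∣ T ∣ ℕ.+ (Vec.sum (padded T) ℕ.+ Vec.sum (padded (∁ S)))
      ≡⟨ cong₂ (λ t s → ∣ S ∣ ∸ ∣ T ∣ ℕ.+ (t ℕ.+ s)) (sum-padded T)
           (trans (sum-padded (∁ S)) (∣∁p∣≡n∸∣p∣ S)) ⟩
    ∣ S ∣ ∸ ∣ T ∣ ℕ.+ (∣ T ∣ ℕ.+ (k ∸ ∣ S ∣))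
      ≡⟨ ℕ.+-assoc (∣ S ∣ ∸ ∣ T ∣) ∣ T ∣ (k ∸ ∣ S ∣) ⟨
    ∣ S ∣ ∸ ∣ T ∣ ℕ.+ ∣ T ∣ ℕ.+ (k ∸ ∣ S ∣)
      ≡⟨ cong (ℕ._+ (k ∸ ∣ S ∣)) (ℕ.m∸n+n≡m T≤S) ⟩
    ∣ S ∣ ℕ.+ (k ∸ ∣ S ∣)
      ≡⟨ ℕ.m+[n∸m]≡n (∣p∣≤n S) ⟩
    k ∎)
    where open ≡-Reasoning

-- If `P α` failed, no term would have exponent `α`, and the collected coefficient would be the
-- empty sum. `P` need not be decidable.
supp⇒exponent : ∀ {n d} (f : Form n d) (P : Pred (Exponent n) 0ℓ) →
  All (P ∘ proj₂) (terms f) → ∀ {α} → supp f α → ¬ ¬ P α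
supp⇒exponent f P Pf {α} α∈f ¬Pα = α∈f (subst (λ ts → sumᶜ (List.map proj₁ ts) ≈ᶜ 0ᶜ)
  (sym (List.filter-none (λ t → Vec.≡-dec ℕ._≟_ (proj₂ t) α)
    (All.map (λ Pβ β≡α → ¬Pα (subst P β≡α Pβ)) Pf)))
  (≈ᶜ-refl 0ᶜ))

1≤sum-ones : ∀ z zs → All (_≡ 1ᶜ) (z ∷ zs) → ∀ n → 1ℚ ℚ.≤ seq (re (sumᶜ (z ∷ zs))) n
1≤sum-ones z []        (refl ∷ [])   n = ℚ.≤-refl
1≤sum-ones z (w ∷ zs) (refl ∷ ones) n =
  ℚ.+-mono-≤ (ℚ.≤-refl {1ℚ}) (ℚ.≤-trans (ℚ.<⇒≤ (ℚ.positive⁻¹ 1ℚ)) (1≤sum-ones w zs ones n))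

-- Ones cannot cancel: every approximation of the real part is at least 1. Repeated exponents in a
-- form are therefore harmless.
sum-ones≉0 : ∀ {z} zs → z ∈ zs → All (_≡ 1ᶜ) zs → sumᶜ zs ≉ᶜ 0ᶜ
sum-ones≉0 (z ∷ zs) _ ones (re≈0 , _) = eventually-⊥ (eventually-map
  (λ {n} small → <⇒≱ℚ small (ℚ.≤-trans (1≤sum-ones z zs ones n)
    (ℚ.≤-trans (p≤∣p∣ _) (ℚ.≤-reflexive (cong ℚ.∣_∣ (sym (p-0≡p _)))))))
  (re≈0 1ℚ (ℚ.positive⁻¹ 1ℚ)))

unit-terms⇒supp : ∀ {n d} (f : Form n d) → All (λ t → proj₁ t ≡ 1ᶜ) (terms f) →
  ∀ {z α} → (z , α) ∈ terms f → supp f α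
unit-terms⇒supp f ones {α = α} α∈f = sum-ones≉0 _
  (∈-map⁺ proj₁ (∈-filter⁺ (λ t → Vec.≡-dec ℕ._≟_ (proj₂ t) α) α∈f refl))
  (All.map⁺ (All.filter⁺ (λ t → Vec.≡-dec ℕ._≟_ (proj₂ t) α) ones))

∈-subsets : ∀ {n} (S : Subset n) → S ∈ subsets n
∈-subsets []            = here refl
∈-subsets (inside  ∷ S) = ∈-++⁺ˡ (∈-map⁺ (inside ∷_) (∈-subsets S))
∈-subsets (outside ∷ S) =
  ∈-++⁺ʳ (List.map (inside ∷_) (subsets _)) (∈-map⁺ (outside ∷_) (∈-subsets S))

elementary-supp⇒squareFree : ∀ n d {α} → supp (elementary n d) α → ¬ ¬ SquareFree α
elementary-supp⇒squareFree n d = supp⇒exponent (elementary n d) SquareFree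
  (All.map⁺ (All.universal indicator-squareFree _))

subset∈elementary-supp : ∀ n d (S : Subset n) → ∣ S ∣ ≡ d → supp (elementary n d) (indicator S)
subset∈elementary-supp n d S ∣S∣≡d = unit-terms⇒supp (elementary n d)
  (All.map⁺ (All.universal (λ _ → refl) _))
  (∈-map⁺ (λ S → 1ᶜ , indicator S) (∈-filter⁺ (λ S → ∣ S ∣ ℕ.≟ d) (∈-subsets S) ∣S∣≡d))

-- Strategies on answers that agree

asked : ∀ {n} → Strategy n → (Point n → ℂ) → List (Point n)
asked (output _)  f = []
asked (query v k) f = v ∷ asked (k (f v)) f

length-asked : ∀ {n} (s : Strategy n) f → length (asked s f) ≡ queries s f
length-asked (output _)  f = refl
length-asked (query v k) f = cong suc (length-asked (k (f v)) f)

-- The answers agree only as complex numbers, so after one query the two runs sit in continuations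
-- that are merely `≋`-related. Their next query points may then differ in representation, which is
-- why `g` has to respect `_≈ᶜ_`.
verdict-cong : ∀ {n} (s s′ : Strategy n) f g → s ≋ s′ →
  (∀ {v w} → Pointwise _≈ᶜ_ v w → g v ≈ᶜ g w) →
  All (λ v → f v ≈ᶜ g v) (asked s f) → verdict s f ≡ verdict s′ g
verdict-cong (output _)  (output _)  f g eq          _ _          = eq
verdict-cong (query v k) (query w l) f g (v≈w , k≋l) g-cong (fv≈gv ∷ agree) =
  verdict-cong (k (f v)) (l (g w)) f g
    (k≋l (f v) (g w) (≈ᶜ-trans (f v) (g v) (g w) fv≈gv (g-cong v≈w))) g-cong agree

-- Lifting a dependence on the queried points to a form

open CommutativeRing ℂ-commutativeRing using (_≈_; _+_; _*_; 0#; 1#; setoid; semiring;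
  *-commutativeSemigroup; *-congˡ; *-congʳ; *-assoc; *-identityˡ; *-identityʳ; +-identityʳ;
  +-identityˡ; +-congˡ; zeroˡ; zeroʳ)
  renaming (*-cong to ·-cong; +-cong to ⊕-cong; refl to ≈-refl; sym to ≈-sym; trans to ≈-trans;
    *-comm to ·-comm)
open SemiringSum semiring using (sum; sum-cong-≋; *-distribˡ-sum)
open CommutativeSemigroupProperties *-commutativeSemigroup using (interchange; x∙yz≈y∙xz)
open SetoidReasoning setoid

^-congˡ : ∀ a {x y} → x ≈ y → x ^ᶜ a ≈ y ^ᶜ a
^-congˡ zero    x≈y = ≈-refl
^-congˡ (suc a) x≈y = ·-cong x≈y (^-congˡ a x≈y)

^-homo-* : ∀ x a b → x ^ᶜ (a ℕ.+ b) ≈ x ^ᶜ a * x ^ᶜ b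
^-homo-* x zero    b = ≈-sym (*-identityˡ (x ^ᶜ b))
^-homo-* x (suc a) b = ≈-trans (*-congˡ (^-homo-* x a b)) (≈-sym (*-assoc x (x ^ᶜ a) (x ^ᶜ b)))

ℂ-stableField : StableField
ℂ-stableField = record
  { commutativeRing = ℂ-commutativeRing
  ; stable          = λ z w ¬¬eq → wrap (≈ᶜ-stable z w λ ne → ¬¬eq (ne ∘ unwrap))
  ; 1≉0             = λ (wrap 1≈0) → sum-ones≉0 _ (here refl) (refl ∷ [])
      (≈ᶜ-trans (1ᶜ +ᶜ 0ᶜ) 1ᶜ 0ᶜ (unwrap (+-identityʳ 1#)) 1≈0)
  ; invertible      = λ z z≉0 ¬inv → ≉0⇒invertible z (z≉0 ∘ wrap)
      λ (w , zw≈1) → ¬inv (w , wrap zw≈1)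
  }

open StableField ℂ-stableField using (stable; invertible)
open Elimination ℂ-stableField using (sum-zero; leading-dependence)

^^-cong : ∀ {n} {v w : Point n} → Pointwise _≈ᶜ_ v w → ∀ α → v ^^ α ≈ w ^^ α
^^-cong []          []      = ≈-refl
^^-cong (x≈y ∷ v≈w) (a ∷ α) = ·-cong (^-congˡ a (wrap x≈y)) (^^-cong v≈w α)

eval-cong : ∀ {n d} (f : Form n d) {v w} → Pointwise _≈ᶜ_ v w → eval f v ≈ eval f w
eval-cong f {v} {w} v≈w = go (terms f)
  where
  go : ∀ ts → sumᶜ (List.map (λ t → proj₁ t *ᶜ v ^^ proj₂ t) ts)
            ≈ sumᶜ (List.map (λ t → proj₁ t *ᶜ w ^^ proj₂ t) ts)
  go []             = ≈-refl
  go ((c , α) ∷ ts) = ⊕-cong (*-congˡ (^^-cong v≈w α)) (go ts)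

^^-homo : ∀ {n} (v : Point n) α β → v ^^ zipWith ℕ._+_ α β ≈ v ^^ α * v ^^ β
^^-homo []      []      []      = ≈-sym (*-identityˡ 1#)
^^-homo (x ∷ v) (a ∷ α) (b ∷ β) = begin
  x ^ᶜ (a ℕ.+ b) * v ^^ zipWith ℕ._+_ α β   ≈⟨ ·-cong (^-homo-* x a b) (^^-homo v α β) ⟩
  (x ^ᶜ a * x ^ᶜ b) * (v ^^ α * v ^^ β)     ≈⟨ interchange (x ^ᶜ a) (x ^ᶜ b) (v ^^ α) (v ^^ β) ⟩
  (x ^ᶜ a * v ^^ α) * (x ^ᶜ b * v ^^ β)     ∎

sumᶜ-filter : ∀ {A : Set} {P : Pred A 0ℓ} (P? : Decidable P) (h : A → ℂ) →
  (∀ x → ¬ P x → h x ≈ 0#) → ∀ xs → sumᶜ (List.map h (filter P? xs)) ≈ sumᶜ (List.map h xs)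
sumᶜ-filter P? h off []       = ≈-refl
sumᶜ-filter P? h off (x ∷ xs) with P? x
... | yes _  = +-congˡ (sumᶜ-filter P? h off xs)
... | no ¬Px = begin
  sumᶜ (List.map h (filter P? xs))     ≈⟨ sumᶜ-filter P? h off xs ⟩
  sumᶜ (List.map h xs)                 ≈⟨ +-identityˡ _ ⟨
  0# + sumᶜ (List.map h xs)            ≈⟨ ⊕-cong (off x ¬Px) ≈-refl ⟨
  h x + sumᶜ (List.map h xs)           ∎

sumᶜ-tabulate : ∀ {N} (h : Fin N → ℂ) → sumᶜ (List.tabulate h) ≡ sum h
sumᶜ-tabulate {zero}  h = refl
sumᶜ-tabulate {suc N} h = cong (h zero +ᶜ_) (sumᶜ-tabulate (h ∘ suc))

^-cancelˡ : ∀ {x b} → x * b ≈ 1# → ∀ p {u w} → x ^ᶜ p * u ≈ x ^ᶜ p * w → u ≈ w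
^-cancelˡ xb≈1 zero {u} {w} eq = ≈-trans (≈-sym (*-identityˡ u)) (≈-trans eq (*-identityˡ w))
^-cancelˡ {x} {b} xb≈1 (suc p) {u} {w} eq = ^-cancelˡ {x} {b} xb≈1 p (begin
  x ^ᶜ p * u               ≈⟨ strip u ⟩
  b * (x ^ᶜ suc p * u)     ≈⟨ *-congˡ eq ⟩
  b * (x ^ᶜ suc p * w)     ≈⟨ strip w ⟨
  x ^ᶜ p * w               ∎)
  where
  strip : ∀ u → x ^ᶜ p * u ≈ b * (x ^ᶜ suc p * u)
  strip u = begin
    x ^ᶜ p * u               ≈⟨ *-identityˡ _ ⟨
    1# * (x ^ᶜ p * u)        ≈⟨ *-congʳ (≈-trans (·-comm b x) xb≈1) ⟨
    b * x * (x ^ᶜ p * u)     ≈⟨ *-assoc b x (x ^ᶜ p * u) ⟩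
    b * (x * (x ^ᶜ p * u))   ≈⟨ *-congˡ (*-assoc x (x ^ᶜ p) u) ⟨
    b * (x ^ᶜ suc p * u)     ∎

module _ (r : ℕ) where

  -- The division is stated with the divisor x₁^(k-∣S∣) multiplied back, so it holds at `x = 0` too.
  lifted-divides : ∀ {k} (x : ℂ) (y : Point (k ℕ.+ r)) (S T : Subset k) → ∣ T ∣ ≤ ∣ S ∣ →
    x ^ᶜ (k ∸ ∣ S ∣) * (x ∷ y) ^^ lifted r S T
      ≈ (x * y ^^ padded r (∁ S)) * (x ∷ y) ^^ monomial r T
  lifted-divides {k} x y S T T≤S = begin
    x ^ᶜ (k ∸ s) * (x ^ᶜ suc (s ∸ t) * y ^^ zipWith ℕ._+_ (padded r T) (padded r (∁ S)))
      ≈⟨ *-congˡ (*-congˡ (^^-homo y (padded r T) (padded r (∁ S)))) ⟩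
    x ^ᶜ (k ∸ s) * (x ^ᶜ suc (s ∸ t) * (Y * Z))
      ≈⟨ *-assoc _ _ _ ⟨
    x ^ᶜ (k ∸ s) * x ^ᶜ suc (s ∸ t) * (Y * Z)
      ≈⟨ *-congʳ (^-homo-* x (k ∸ s) (suc (s ∸ t))) ⟨
    x ^ᶜ (k ∸ s ℕ.+ suc (s ∸ t)) * (Y * Z)
      ≡⟨ cong (λ p → x ^ᶜ p * (Y * Z)) exponents ⟩
    x * x ^ᶜ (k ∸ t) * (Y * Z)
      ≈⟨ *-congˡ (·-comm Y Z) ⟩
    x * x ^ᶜ (k ∸ t) * (Z * Y)
      ≈⟨ interchange x (x ^ᶜ (k ∸ t)) Z Y ⟩
    x * Z * (x ^ᶜ (k ∸ t) * Y) ∎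
    where
    s t : ℕ
    s = ∣ S ∣
    t = ∣ T ∣
    Y Z : ℂ
    Y = y ^^ padded r T
    Z = y ^^ padded r (∁ S)
    -- No subtraction truncates, because t ≤ s ≤ k.
    exponents : k ∸ s ℕ.+ suc (s ∸ t) ≡ suc (k ∸ t)
    exponents = trans (ℕ.+-suc (k ∸ s) (s ∸ t)) (cong suc
      (trans (sym (ℕ.+-∸-assoc (k ∸ s) T≤S)) (cong (_∸ t) (ℕ.m∸n+n≡m (∣p∣≤n S)))))

  -- If x ≉ 0, divide the given relation, multiplied by x · y^(∁S), by a power
  -- of x; if x ≈ 0, every term vanishes because lifted exponents have positive
  -- first entry.
  lift-relation : ∀ {k N} (v : Point (suc k ℕ.+ r)) (S : Subset k) (T : Fin N → Subset k)
    (a : Fin N → ℂ) →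
    (∀ j → ∣ S ∣ ℕ.< ∣ T j ∣ → a j ≈ 0#) →
    v ^^ monomial r S ≈ sum (λ j → a j * v ^^ monomial r (T j)) →
    v ^^ lifted r S S ≈ sum (λ j → a j * v ^^ lifted r S (T j))
  lift-relation {k} v@(x ∷ y) S T a top relation = stable _ _ λ ≉ →
    ¬¬-excluded-middle {A = x ≈ 0#} λ
    { (yes x≈0) → ≉ (begin
        v ^^ lifted r S S                        ≈⟨ vanish x≈0 S ⟩
        0#
          ≈⟨ sum-zero _ (λ j → ≈-trans (*-congˡ (vanish x≈0 (T j))) (zeroʳ (a j))) ⟨
        sum (λ j → a j * v ^^ lifted r S (T j))  ∎)
    ; (no x≉0) → invertible x x≉0 λ (b , xb≈1) → ≉ (^-cancelˡ xb≈1 (k ∸ ∣ S ∣) (begin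
        X * v ^^ lifted r S S                          ≈⟨ lifted-divides x y S S ℕ.≤-refl ⟩
        Q * v ^^ monomial r S                          ≈⟨ *-congˡ relation ⟩
        Q * sum (λ j → a j * v ^^ monomial r (T j))
          ≈⟨ *-distribˡ-sum Q (λ j → a j * v ^^ monomial r (T j)) ⟩
        sum (λ j → Q * (a j * v ^^ monomial r (T j)))  ≈⟨ sum-cong-≋ termwise ⟩
        sum (λ j → X * (a j * v ^^ lifted r S (T j)))
          ≈⟨ *-distribˡ-sum X (λ j → a j * v ^^ lifted r S (T j)) ⟨
        X * sum (λ j → a j * v ^^ lifted r S (T j))    ∎))
    }
    where
    X Q : ℂ
    X = x ^ᶜ (k ∸ ∣ S ∣)
    Q = x * y ^^ padded r (∁ S)
    vanish : x ≈ 0# → ∀ T → v ^^ lifted r S T ≈ 0#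
    vanish x≈0 T = begin
      x * x ^ᶜ (∣ S ∣ ∸ ∣ T ∣) * _   ≈⟨ *-congʳ (*-congʳ x≈0) ⟩
      0# * x ^ᶜ (∣ S ∣ ∸ ∣ T ∣) * _  ≈⟨ *-congʳ (zeroˡ _) ⟩
      0# * _                         ≈⟨ zeroˡ _ ⟩
      0#                             ∎
    termwise : ∀ j → Q * (a j * v ^^ monomial r (T j)) ≈ X * (a j * v ^^ lifted r S (T j))
    termwise j with ∣ T j ∣ ℕ.≤? ∣ S ∣
    ... | yes T≤S = begin
      Q * (a j * v ^^ monomial r (T j))   ≈⟨ x∙yz≈y∙xz Q (a j) _ ⟩
      a j * (Q * v ^^ monomial r (T j))   ≈⟨ *-congˡ (lifted-divides x y S (T j) T≤S) ⟨
      a j * (X * v ^^ lifted r S (T j))   ≈⟨ x∙yz≈y∙xz (a j) X _ ⟩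
      X * (a j * v ^^ lifted r S (T j))   ∎
    -- For larger `T j` the division fails, but the coefficient is zero by `top`.
    ... | no T≰S = ≈-trans (kill Q _) (≈-sym (kill X _))
      where
      kill : ∀ u w → u * (a j * w) ≈ 0#
      kill u w = ≈-trans (*-congˡ (≈-trans (*-congʳ (top j (ℕ.≰⇒> T≰S))) (zeroˡ w))) (zeroʳ u)

  -- A form without squarefree monomials that agrees with the product on given points

  productForm : ∀ k → Form (suc k ℕ.+ r) (suc k)
  productForm k = mkForm ((1ᶜ , indicator (full r k)) ∷ [])
    (trans (sum-indicator (full r k)) (∣full∣ r k) ∷ [])

  eval-productForm : ∀ k v → eval (productForm k) v ≈ v ^^ indicator (full r k)
  eval-productForm k v = ≈-trans (+-identityʳ _) (*-identityˡ _)

  -- The condition is on all listed exponents, not only those in the support, so no coefficient has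
  -- to be tested for zero.
  Indistinguishable : ∀ k → List (Point (suc k ℕ.+ r)) → Form (suc k ℕ.+ r) (suc k) → Set
  Indistinguishable k vs f =
    All (λ α → ¬ SquareFree α) (List.map proj₂ (terms f)) ×
    All (λ v → eval (productForm k) v ≈ eval f v) vs

  module _ {k N} (S : Subset k) (T : Fin N → Subset k) (a : Fin N → ℂ) where

    small? : Decidable λ j → ∣ T j ∣ ≤ ∣ S ∣
    small? j = ∣ T j ∣ ℕ.≤? ∣ S ∣

    -- Sets larger than `S` are filtered out because their lifted exponents have too high a degree,
    -- the subtraction being truncated.
    liftedForm : Form (suc k ℕ.+ r) (suc k)
    liftedForm = mkForm (List.map (λ j → a j , lifted r S (T j)) (filter small? (allFin N)))
      (All.map⁺ (All.map (λ {j} → sum-lifted r S (T j)) (All.all-filter small? (allFin N))))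

    eval-liftedForm : (∀ j → ∣ S ∣ ℕ.< ∣ T j ∣ → a j ≈ 0#) → ∀ v →
      eval liftedForm v ≈ sum (λ j → a j * v ^^ lifted r S (T j))
    eval-liftedForm top v = begin
      sumᶜ (List.map _ (List.map _ (filter small? (allFin N))))
        ≡⟨ cong sumᶜ (List.map-∘ (filter small? (allFin N))) ⟨
      sumᶜ (List.map h (filter small? (allFin N)))
        -- The omitted terms have zero coefficients, so they can be put back.
        ≈⟨ sumᶜ-filter small? h (λ j T≰S → ≈-trans (*-congʳ (top j (ℕ.≰⇒> T≰S))) (zeroˡ _))
             (allFin N) ⟩
      sumᶜ (List.map h (allFin N))
        ≡⟨ cong sumᶜ (List.map-tabulate (λ j → j) h) ⟩
      sumᶜ (List.tabulate h)
        ≡⟨ sumᶜ-tabulate h ⟩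
      sum h ∎
      where
      h : Fin N → ℂ
      h j = a j * v ^^ lifted r S (T j)

  -- The points are the rows and the monomials the columns, so fewer points than monomials force a
  -- dependence. The weight of a column is the size of its set.
  indistinguishable-form : ∀ {k N} (T : Fin N → Subset k) → (∀ i j → T i ≡ T j → i ≡ j) →
    ∀ vs → length vs ℕ.< N → ¬ ¬ ∃ (Indistinguishable k vs)
  indistinguishable-form {k} {suc N} T T-injective vs vs<N K =
    leading-dependence (List.map (λ v j → v ^^ monomial r (T j)) vs)
      (subst (ℕ._< suc N) (sym (List.length-map (λ v j → v ^^ monomial r (T j)) vs)) vs<N)
      (∣_∣ ∘ T) (∣p∣≤n ∘ T)
      λ (s , a , top , relations) → K
        ( liftedForm (T s) (T ∘ punchIn s) a
        -- `punchIn s` skips `s`, so no remaining set equals `T s`, the only one with a squarefree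
        -- lift.
        , All.map⁺ (All.map⁺ (All.universal (λ j sf → Fin.punchInᵢ≢i s j
            (T-injective (punchIn s j) s (lifted-squareFree r (T s) (T (punchIn s j)) sf))) _))
        , All.map (λ {v} relation → begin
            eval (productForm k) v
              ≈⟨ eval-productForm k v ⟩
            v ^^ indicator (full r k)
              ≡⟨ cong (v ^^_) (lifted-self r (T s)) ⟨
            v ^^ lifted r (T s) (T s)
              ≈⟨ lift-relation v (T s) (T ∘ punchIn s) a top relation ⟩
            sum (λ j → a j * v ^^ lifted r (T s) (T (punchIn s j)))
              ≈⟨ eval-liftedForm (T s) (T ∘ punchIn s) a top v ⟨
            eval (liftedForm (T s) (T ∘ punchIn s) a) v ∎)
          (All.map⁻ relations))

  -- One accepting run on the product suffices. The form `g` is built after the points asked in that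
  -- run, and with the same ω the algorithm repeats its verdict on `g`.
  query-bound : ∀ k {δ} → δ <ᴿ 1ᴿ → (A : RandomizedAlgorithm (suc k ℕ.+ r) (suc k)) →
    CertifiesIntersection (elementary (suc k ℕ.+ r) (suc k)) δ A → WorstCaseQueries≥ A (2 ^ k)
  query-bound k {δ} δ<1 A certifies q bounded = ℕ.≮⇒≥ λ q<2^k →
    positive⇒¬Empty space (measurable intersecting f) {δ} δ<1 (on-intersecting f f-intersects)
    λ ω accepts →
      indistinguishable-form (subset k) (subset-injective k) (asked (strategy ω) (eval f))
        (ℕ.≤-<-trans (ℕ.≤-trans (ℕ.≤-reflexive (length-asked (strategy ω) (eval f))) (bounded f ω))
          q<2^k)
        λ (g , g-free , agree) → contradiction
          (trans (sym accepts) (trans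
            (verdict-cong (strategy ω) (strategy ω) (eval f) (eval g) (extensional ω)
              (λ v≈w → unwrap (eval-cong g v≈w)) (All.map unwrap agree))
            (on-disjoint g (λ α (α∈g , α∈e) →
              -- A common exponent would be both squarefree and not, each up to double negation.
              supp⇒exponent g (λ α → ¬ SquareFree α) (All.map⁻ g-free) α∈g
                (elementary-supp⇒squareFree (suc k ℕ.+ r) (suc k) α∈e)) ω)))
          λ ()
    where
    open RandomizedAlgorithm A
    open CertifiesIntersection certifies
    f : Form (suc k ℕ.+ r) (suc k)
    f = productForm k
    f-intersects : Satisfiable (supp f ∩ supp (elementary (suc k ℕ.+ r) (suc k)))
    f-intersects = indicator (full r k) ,
      unit-terms⇒supp f (refl ∷ []) (here refl) ,
      subset∈elementary-supp (suc k ℕ.+ r) (suc k) (full r k) (∣full∣ r k)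

theorem24 : (n d : ℕ) → 1 ≤ d → d ≤ n →
    (δ : ℝ) → 0ᴿ <ᴿ δ → δ <ᴿ 1ᴿ →
    (A : RandomizedAlgorithm n d) → CertifiesIntersection (elementary n d) δ A →
    WorstCaseQueries≥ A (2 ^ (d ∸ 1))
theorem24 n (suc k) _ d≤n δ _ δ<1 with ℕ.m≤n⇒∃[o]m+o≡n d≤n
-- The first `d` variables carry the product, and the other `r` never occur.
... | r , refl = query-bound r k {δ} δ<1
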